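{- Let $(\mathbf{G},\cdot)$ be a nilpotent group, let $\mathcal{F}$ be an idempotent filter on $\mathbf{G}$, and let $\mathcal{P}$ be a good collection of $\mathcal{F}$-measurable polynomial mappings $\mathcal{F}(\mathbb{N})\to\mathbf{G}$. Then for all $P_1,\ldots,P_k\in\mathcal{P}$ and every $\mathcal{F}$-syndetic set $A\subset\mathbf{G}$ there exist $\alpha\in\mathcal{F}(\mathbb{N})$ and $a\in\mathbf{G}$ such that $\{P_1(\alpha)a,\ldots,P_k(\alpha)a\}\subset A$.
   Context: $\mathcal{F}(X)$ denotes the collection of all non-empty finite subsets of a set $X$; for $\alpha,\beta\in\mathcal{F}(\mathbb{N})$ write $\alpha<\beta$ if $\max\alpha<\min\beta$. A map $x:\mathcal{F}(\mathbb{N})\to\mathbf{G}$ is an IP mapping if $x(\alpha\cup\beta)=x(\alpha)x(\beta)$ whenever $\alpha<\beta$. Let $\mathbb{E}=\{V\subset\mathcal{F}(\mathbb{N}):\exists\beta\text{ with }\{\alpha\in\mathcal{F}(\mathbb{N}):\alpha>\beta\}\subset V\}$; two maps $x,y:\mathcal{F}(\mathbb{N})\to\mathbf{G}$ are equal $\mathbb{E}$-a.e. if $\{\alpha:x(\alpha)=y(\alpha)\}\in\mathbb{E}$. For $x:\mathcal{F}(\mathbb{N})\to\mathbf{G}$ and $\beta\in\mathcal{F}(\mathbb{N})$, the derivative is $D_\beta x(\alpha)=x(\alpha)^{ -1}x(\alpha\cup\beta)x(\beta)^{ -1}$. A map $P$ is a polynomial mapping of degree $1$ if it equals some IP mapping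 $\mathbb{E}$-a.e.; for $d>1$, $P$ is a polynomial mapping of degree $d$ if $\{\beta: D_\beta P\text{ is a polynomial mapping of degree }d-1\}\in\mathbb{E}$. A polynomial mapping is one of some degree $d\ge1$. A filter on $\mathbf{G}$ is a nonempty family of subsets not containing $\emptyset$, closed under supersets and finite intersections. The product of filters is defined by $A\in\mathcal{F}\cdot\mathcal{G}$ iff $\{x:\{y:xy\in A\}\in\mathcal{G}\}\in\mathcal{F}$; $\mathcal{F}$ is idempotent if $\mathcal{F}\cdot\mathcal{F}\supset\mathcal{F}$. A set $A\subset\mathbf{G}$ is $\mathcal{F}$-syndetic if for every $V\in\mathcal{F}$ there is a finite non-empty $K\subset V$ with $K^{ -1}A=\{k^{ -1}a:k\in K,a\in A\}\in\mathcal{F}$. A map $x:\mathcal{F}(\mathbb{N})\to\mathbf{G}$ is $\mathcal{F}$-measurable if $x^{ -1}(V\cup\{1_{\mathbf{G}}\})\in\mathbb{E}$ for all $V\in\mathcal{F}$. Write $u^c=c^{ -1}uc$ and $[u,c]=u^{ -1}c^{ -1}uc$ (applied pointwise to mappings). A collection $\mathcal{P}$ of polynomial mappings into $\mathbf{G}$ is a good collection of $\mathcal{F}$-measurable polynomial mappings if: (I) the constant map $1_{\mathbf{G}}$ is in $\mathcal{P}$; (II) every $P\in\mathcal{P}$ is $\mathcal{F}$-measurable; (III) for all $R,P\in\mathcal{P}$, $\{c\in\mathbf{G}:R^c[c,P]\in\mathcal{P}\}\in\mathcal{F}$; (IV) for all $R,P\in\mathcal{P}$ there are $C\in\mathcal{F}$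 and $\mathcal{T}\in\mathbb{E}$ such that $(R\,D_\beta P)^c\in\mathcal{P}$ for all $c\in C$ and $\beta\in\mathcal{T}$. -}

module Defs where

open import Data.Nat using (ℕ; zero; suc; _+_; _<_; compare; less; equal; greater)
open import Data.List using (List; []; _∷_; foldr; last)
open import Data.List.NonEmpty using (List⁺; toList)
open import Data.List.Relation.Unary.All using (All)
open import Data.List.Relation.Unary.Any using (Any)
open import Data.Maybe using (maybe)
open import Data.Product using (Σ; ∃; ∃-syntax; _×_; _,_; proj₁)
open import Data.Sum using (_⊎_)
open import Data.Empty using (⊥)
open import Relation.Nullary using (¬_)
open import Relation.Binary.PropositionalEquality using (_≡_)

-- 𝓕(ℕ): non-empty finite subsets of ℕ, in a canonical "gap" encoding.
-- (m , d₁ ∷ d₂ ∷ …) encodes the set {e₀ < e₁ < e₂ < …} with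
-- e₀ = m and eᵢ₊₁ = eᵢ + dᵢ₊₁ + 1.  Every non-empty finite subset of ℕ
-- has exactly one code, so maps 𝓕ℕ → G are exactly maps 𝓕(ℕ) → G.

𝓕ℕ : Set
𝓕ℕ = ℕ × List ℕ

elemsFrom : ℕ → List ℕ → List ℕ
elemsFrom b []       = []
elemsFrom b (d ∷ ds) = suc (b + d) ∷ elemsFrom (suc (b + d)) ds

elems : 𝓕ℕ → List ℕ
elems (m , ds) = m ∷ elemsFrom m ds

minF : 𝓕ℕ → ℕ
minF = proj₁

maxF : 𝓕ℕ → ℕ
maxF (m , ds) = maybe (λ e → e) m (last (elemsFrom m ds))

-- insert offset k (element b + k + 1, b = previous element) into a gap list
insRel : ℕ → List ℕ → List ℕ
insRel k [] = k ∷ []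
insRel k (d ∷ ds) with compare k d
... | less .k j    = k ∷ j ∷ ds
... | equal .k     = d ∷ ds
... | greater .d j = d ∷ insRel j ds

insertF : ℕ → 𝓕ℕ → 𝓕ℕ
insertF n (m , ds) with compare n m
... | less .n j    = n , j ∷ ds
... | equal .n     = m , ds
... | greater .m j = m , insRel j ds

_∪F_ : 𝓕ℕ → 𝓕ℕ → 𝓕ℕ
α ∪F β = foldr insertF β (elems α)

_≺_ : 𝓕ℕ → 𝓕ℕ → Set
α ≺ β = maxF α < minF β

InE : (𝓕ℕ → Set) → Set
InE V = ∃[ β ] (∀ α → β ≺ α → V α)

module GroupNotions {G : Set} (_∙_ : G → G → G) (ε : G) (_⁻¹ : G → G) where

  [_,_] : G → G → G
  [ u , c ] = (((u ⁻¹) ∙ (c ⁻¹)) ∙ u) ∙ c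

  _^_ : G → G → G
  u ^ c = ((c ⁻¹) ∙ u) ∙ c

  data γ : ℕ → G → Set where
    γ-all : ∀ g → γ zero g
    γ-gen : ∀ {i x} g → γ i x → γ (suc i) [ x , g ]
    γ-one : ∀ {i} → γ (suc i) ε
    γ-mul : ∀ {i x y} → γ (suc i) x → γ (suc i) y → γ (suc i) (x ∙ y)
    γ-inv : ∀ {i x} → γ (suc i) x → γ (suc i) (x ⁻¹)

  Nilpotent : Set
  Nilpotent = ∃[ c ] (∀ x → γ c x → x ≡ ε)

  IsIP : (𝓕ℕ → G) → Set
  IsIP x = ∀ α β → α ≺ β → x (α ∪F β) ≡ x α ∙ x β

  _≐E_ : (𝓕ℕ → G) → (𝓕ℕ → G) → Set
  x ≐E y = InE (λ α → x α ≡ y α)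

  D : 𝓕ℕ → (𝓕ℕ → G) → (𝓕ℕ → G)
  D β x α = ((x α ⁻¹) ∙ x (α ∪F β)) ∙ (x β ⁻¹)

  -- PolyDeg n P : P is a polynomial mapping of degree n + 1
  PolyDeg : ℕ → (𝓕ℕ → G) → Set
  PolyDeg zero    P = ∃[ x ] (IsIP x × P ≐E x)
  PolyDeg (suc n) P = InE (λ β → PolyDeg n (D β P))

  IsPolynomial : (𝓕ℕ → G) → Set
  IsPolynomial P = ∃[ n ] PolyDeg n P

  Subset : Set₁
  Subset = G → Set

  record IsFilter (𝓕 : Subset → Set) : Set₁ where
    field
      nonempty : ∃[ A ] 𝓕 A
      no-∅     : ¬ 𝓕 (λ _ → ⊥)
      upward   : ∀ {A B} → 𝓕 A → (∀ x → A x → B x) → 𝓕 B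
      inter    : ∀ {A B} → 𝓕 A → 𝓕 B → 𝓕 (λ x → A x × B x)

  _·F_ : (Subset → Set) → (Subset → Set) → (Subset → Set)
  (𝓕 ·F 𝓖) A = 𝓕 (λ x → 𝓖 (λ y → A (x ∙ y)))

  Idempotent : (Subset → Set) → Set₁
  Idempotent 𝓕 = ∀ A → 𝓕 A → (𝓕 ·F 𝓕) A

  invMul : List⁺ G → Subset → Subset
  invMul K A g = Any (λ k → ∃[ a ] (A a × g ≡ (k ⁻¹) ∙ a)) (toList K)

  Syndetic : (Subset → Set) → Subset → Set₁
  Syndetic 𝓕 A = ∀ V → 𝓕 V → Σ (List⁺ G) (λ K → All V (toList K) × 𝓕 (invMul K A))

  Measurable : (Subset → Set) → (𝓕ℕ → G) → Set₁
  Measurable 𝓕 x = ∀ V → 𝓕 V → InE (λ α → V (x α) ⊎ x α ≡ ε)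

  record GoodCollection (𝓕 : Subset → Set) (𝒫 : (𝓕ℕ → G) → Set) : Set₁ where
    field
      poly   : ∀ P → 𝒫 P → IsPolynomial P
      const  : 𝒫 (λ _ → ε)
      meas   : ∀ P → 𝒫 P → Measurable 𝓕 P
      condIII : ∀ R P → 𝒫 R → 𝒫 P →
                𝓕 (λ c → 𝒫 (λ α → (R α ^ c) ∙ [ c , P α ]))
      condIV : ∀ R P → 𝒫 R → 𝒫 P →
               Σ Subset (λ C → 𝓕 C × Σ (𝓕ℕ → Set) (λ T → InE T ×
                 (∀ c β → C c → T β → 𝒫 (λ α → (R α ∙ D β P α) ^ c))))

{-# OPTIONS --safe #-}
module Submission where

open import Defs
open import Level using (0ℓ)
open import Data.Bool using (Bool; true; false; not) renaming (T to True)
open import Data.Empty using (⊥; ⊥-elim)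
open import Data.Fin using (Fin; zero; suc)
import Data.Fin.Properties as Fin
open import Data.List using (List; []; _∷_; _++_; foldr; last; length; map; allFin; concatMap; cartesianProductWith) renaming (lookup to lookupᴸ)
open import Data.List.Membership.Propositional using (_∈_; lose)
open import Data.List.Membership.Propositional.Properties using (∈-map⁺; ∈-++⁺ˡ; ∈-++⁺ʳ; ∈-allFin; ∈-concatMap⁺; ∈-cartesianProductWith⁺; ∈-lookup)
open import Data.List.NonEmpty using (toList; head)
open import Data.List.Properties using (++-assoc; map-++; map-∘)
open import Data.List.Relation.Unary.All as All using (All; []; _∷_)
import Data.List.Relation.Unary.All.Properties as All
open import Data.List.Relation.Unary.Any as Any using (Any; here; there)
import Data.List.Relation.Unary.Any.Properties as Any
open import Data.Maybe using (Maybe; just; nothing; maybe)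
open import Data.Nat using (ℕ; zero; suc; _+_; _*_; _≤_; _<_; _⊔_; z≤n; s≤s; s≤s⁻¹; compare; less; greater)
open import Data.Nat.DivMod using (_/_; m≡m%n+[m/n]*n; m%n<n; m/n*n≤m)
open import Data.Nat.Properties
open import Data.Product using (Σ; ∃; ∃-syntax; _×_; _,_; proj₁; proj₂)
open import Data.Sum using (_⊎_; inj₁; inj₂)
open import Data.Unit using (⊤; tt)
open import Data.Vec using (Vec; lookup) renaming ([] to []ⱽ; _∷_ to _∷ⱽ_)
open import Relation.Binary.PropositionalEquality using (_≡_; refl; sym; trans; cong; cong₂; subst; module ≡-Reasoning)
import Relation.Binary.Reflection
open import Relation.Nullary using (¬_; Dec; yes; no)
open import Algebra.Bundles using (Group)
open import Algebra.Structures using (IsGroup)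
import Algebra.Properties.Group

-- A finite colouring argument.  A system is a finite set of members of 𝒫 with a base N; by
-- PET induction, for every finite colouring of a set of 𝓕 there is a monochromatic pattern
-- {N(α)x} ∪ {R(α)x}.  Condition III says exactly that the differences R N⁻¹ may be conjugated
-- by 𝓕-many constants without changing the base: z (R^z [z,N])(α) x = R(α) x′ with x′ = N(α)⁻¹ z N(α) x.
--
-- Weights.  W t is the smallest filtration of the group of maps (up to 𝔼-a.e. equality)
-- containing the derivatives of the given polynomials and the constants, with
-- [W s , W t] ⊆ W (s + t).  Translation α ↦ α ∪ β acts trivially on W t / W (t + 1), and the value
-- at ∅ of an element of W t lies in a term of the lower central series that is trivial for
-- large t.  Hence differences R N⁻¹ are classified by a level t and a coset of W (t + 1), and
-- this class is unchanged by conjugation and by R ↦ (R D_β R)^c.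
--
-- Focusing.  Given patterns at β₁,…,βₙ with distinct colours and a common focus f, condition IV
-- makes (R D_βⱼ R)^(R(βⱼ)x) a system of the same classes.  Taking as new base a member of
-- the class of highest level lowers the weight, so the induction hypothesis provides one more
-- colour.  As there are finitely many colours this stops.  The systems of different partial
-- chains have different bases, so they cannot be merged; instead they are treated
-- successively, the next one being conjugated by all points queried so far.

-- Unions of finite sets in the gap encoding.

compare-greater : ∀ m k → compare (suc (m + k)) m ≡ greater m k
compare-greater zero    k = refl
compare-greater (suc m) k rewrite compare-greater m k = refl

compare-less : ∀ m k → compare m (suc (m + k)) ≡ less m k
compare-less zero    k = refl
compare-less (suc m) k rewrite compare-less m k = refl

top : ℕ → List ℕ → ℕ
top m []       = m
top m (d ∷ ds) = top (suc (m + d)) ds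

last-top : ∀ x m d ds → maybe (λ e → e) x (last (elemsFrom m (d ∷ ds))) ≡ top m (d ∷ ds)
last-top x m d []       = refl
last-top x m d (e ∷ ds) = last-top x (suc (m + d)) e ds

maxF-top : ∀ m ds → maxF (m , ds) ≡ top m ds
maxF-top m []       = refl
maxF-top m (d ∷ ds) = last-top m m d ds

top-++ : ∀ m ds j es → top m (ds ++ j ∷ es) ≡ top (suc (top m ds + j)) es
top-++ m []       j es = refl
top-++ m (d ∷ ds) j es = top-++ (suc (m + d)) ds j es

excess : List ℕ → ℕ
excess []       = 0
excess (d ∷ ds) = suc (d + excess ds)

top≡ : ∀ m ds → top m ds ≡ m + excess ds
top≡ m []       = sym (+-identityʳ m)
top≡ m (d ∷ ds) = trans (top≡ (suc (m + d)) ds) (trans (cong suc (+-assoc m d _)) (sym (+-suc m _)))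

insRel-end : ∀ ds j → insRel (excess ds + j) ds ≡ ds ++ j ∷ []
insRel-end []       j = refl
insRel-end (d ∷ ds) j rewrite +-assoc d (excess ds) j | compare-greater d (excess ds + j) | insRel-end ds j = refl

-- `_∪F_` inserts the largest element first; in a union with a lower set each further element then
-- splits the gap below the one inserted before it.
insRel-mid : ∀ ds j k es → insRel (excess ds + j) (ds ++ suc (j + k) ∷ es) ≡ ds ++ j ∷ k ∷ es
insRel-mid []       j k es rewrite compare-less j k = refl
insRel-mid (d ∷ ds) j k es rewrite +-assoc d (excess ds) j | compare-greater d (excess ds + j) | insRel-mid ds j k es = refl

insertF-end : ∀ m ds j → insertF (suc (top m ds + j)) (m , ds) ≡ (m , ds ++ j ∷ [])
insertF-end m ds j rewrite top≡ m ds | +-assoc m (excess ds) j | compare-greater m (excess ds + j) | insRel-end ds j = refl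

insertF-mid : ∀ m ds j k es → insertF (suc (top m ds + j)) (m , ds ++ suc (j + k) ∷ es) ≡ (m , ds ++ j ∷ k ∷ es)
insertF-mid m ds j k es rewrite top≡ m ds | +-assoc m (excess ds) j | compare-greater m (excess ds + j) | insRel-mid ds j k es = refl

insertF-front : ∀ m j es → insertF m (suc (m + j) , es) ≡ (m , j ∷ es)
insertF-front m j es rewrite compare-less m j = refl

∪F-above : ∀ m ds j es → (suc (top m ds + j) , es) ∪F (m , ds) ≡ (m , ds ++ j ∷ es)
∪F-above m ds j []       = insertF-end m ds j
∪F-above m ds j (e ∷ es) =
  trans (cong (λ k → insertF (suc (top m ds + j)) (k ∪F′ (m , ds))) lem)
        (trans (cong (insertF (suc (top m ds + j))) (∪F-above m ds (suc (j + e)) es)) (insertF-mid m ds j e es))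
  where
  _∪F′_ : ℕ → 𝓕ℕ → 𝓕ℕ
  k ∪F′ β = foldr insertF β (k ∷ elemsFrom k es)
  lem : suc (suc (top m ds + j) + e) ≡ suc (top m ds + suc (j + e))
  lem = cong suc (trans (cong suc (+-assoc (top m ds) j e)) (sym (+-suc (top m ds) (j + e))))

∪F-below : ∀ m ds j es → (m , ds) ∪F (suc (top m ds + j) , es) ≡ (m , ds ++ j ∷ es)
∪F-below m []       j es = insertF-front m j es
∪F-below m (d ∷ ds) j es =
  trans (cong (insertF m) (∪F-below (suc (m + d)) ds j es)) (insertF-front m d (ds ++ j ∷ es))

≺-split : ∀ {β α} → β ≺ α → ∃[ j ] (α ≡ (suc (top (proj₁ β) (proj₂ β) + j) , proj₂ α))
≺-split {m , ds} {n , es} lt with m≤n⇒∃[o]m+o≡n (subst (_< n) (maxF-top m ds) lt)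
... | j , p = j , cong (_, es) (sym p)

∪F-comm : ∀ {β α} → β ≺ α → α ∪F β ≡ β ∪F α
∪F-comm {m , ds} {α} lt with ≺-split {m , ds} {α} lt
... | j , p rewrite p = trans (∪F-above m ds j _) (sym (∪F-below m ds j _))

minF-∪F : ∀ {β α} → β ≺ α → minF (α ∪F β) ≡ minF β
minF-∪F {m , ds} {α} lt with ≺-split {m , ds} {α} lt
... | j , p rewrite p = cong minF (∪F-above m ds j (proj₂ α))

maxF-∪F : ∀ {β α} → β ≺ α → maxF (α ∪F β) ≡ maxF α
maxF-∪F {m , ds} {α} lt with ≺-split {m , ds} {α} lt
... | j , p rewrite p | ∪F-above m ds j (proj₂ α) | maxF-top m (ds ++ j ∷ proj₂ α) | maxF-top (suc (top m ds + j)) (proj₂ α) = top-++ m ds j _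

∪F-assoc : ∀ {γ β α} → γ ≺ β → β ≺ α → α ∪F (β ∪F γ) ≡ (α ∪F β) ∪F γ
∪F-assoc {m , ds} {β} {α} lt lt′ with ≺-split {m , ds} {β} lt
... | j , refl with ≺-split {β} {α} lt′
... | k , refl = begin
    α ∪F (β ∪F (m , ds))                ≡⟨ cong (α ∪F_) (∪F-above m ds j es) ⟩
    α ∪F (m , ds ++ j ∷ es)             ≡⟨ cong (λ t → (suc (t + k) , fs) ∪F (m , ds ++ j ∷ es)) (sym (top-++ m ds j es)) ⟩
    (suc (top m (ds ++ j ∷ es) + k) , fs) ∪F (m , ds ++ j ∷ es)
                                        ≡⟨ ∪F-above m (ds ++ j ∷ es) k fs ⟩
    (m , (ds ++ j ∷ es) ++ k ∷ fs)      ≡⟨ cong (m ,_) (++-assoc ds (j ∷ es) (k ∷ fs)) ⟩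
    (m , ds ++ j ∷ es ++ k ∷ fs)        ≡⟨ sym (∪F-above m ds j (es ++ k ∷ fs)) ⟩
    (suc (top m ds + j) , es ++ k ∷ fs) ∪F (m , ds)
                                        ≡⟨ cong (_∪F (m , ds)) (sym (∪F-above (suc (top m ds + j)) es k fs)) ⟩
    (α ∪F β) ∪F (m , ds)                ∎
  where
  open ≡-Reasoning
  es = proj₂ β
  fs = proj₂ α

-- Group identities by free reduction of words.

module GroupSolver {G : Set} (op : G → G → G) (e : G) (inv : G → G) (isGroup : IsGroup _≡_ op e inv) where

  group : Group 0ℓ 0ℓ
  group = record { isGroup = isGroup }

  open Group group public using (_∙_; ε; _⁻¹; assoc; identityˡ; identityʳ; inverseˡ; inverseʳ)
  open Algebra.Properties.Group group public using (ε⁻¹≈ε; ⁻¹-involutive; ⁻¹-anti-homo-∙)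

  infixl 7 _:∙_
  infix 8 _:⁻¹

  data Expr (n : ℕ) : Set where
    var  : Fin n → Expr n
    :ε   : Expr n
    _:∙_ : Expr n → Expr n → Expr n
    _:⁻¹ : Expr n → Expr n

  ⟦_⟧ : ∀ {n} → Expr n → Vec G n → G
  ⟦ var i ⟧ ρ  = lookup ρ i
  ⟦ :ε ⟧ ρ     = ε
  ⟦ s :∙ t ⟧ ρ = ⟦ s ⟧ ρ ∙ ⟦ t ⟧ ρ
  ⟦ s :⁻¹ ⟧ ρ  = ⟦ s ⟧ ρ ⁻¹

  Word : ℕ → Set
  Word n = List (Bool × Fin n)

  signed : Bool → G → G
  signed true  g = g
  signed false g = g ⁻¹

  ⟦_⟧ʷ : ∀ {n} → Word n → Vec G n → G
  ⟦ [] ⟧ʷ ρ          = ε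
  ⟦ (b , i) ∷ w ⟧ʷ ρ = signed b (lookup ρ i) ∙ ⟦ w ⟧ʷ ρ

  push : ∀ {n} → Bool → Fin n → Word n → Word n
  push b i [] = (b , i) ∷ []
  push true i ((false , j) ∷ w) with i Fin.≟ j
  ... | yes _ = w
  ... | no _  = (true , i) ∷ (false , j) ∷ w
  push false i ((true , j) ∷ w) with i Fin.≟ j
  ... | yes _ = w
  ... | no _  = (false , i) ∷ (true , j) ∷ w
  push b i (x ∷ w) = (b , i) ∷ x ∷ w

  -- `false` means that the expression occurs inverted; the last argument is the reduced word to its
  -- right.
  norm : ∀ {n} → Bool → Expr n → Word n → Word n
  norm b (var i) w = push b i w
  norm b :ε w = w
  norm true (s :∙ t) w = norm true s (norm true t w)
  norm false (s :∙ t) w = norm false t (norm false s w)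
  norm b (s :⁻¹) w = norm (not b) s w

  cancelˡ : ∀ x y → x ∙ ((x ⁻¹) ∙ y) ≡ y
  cancelˡ x y = trans (sym (assoc x (x ⁻¹) y)) (trans (cong (_∙ y) (inverseʳ x)) (identityˡ y))

  cancelˡ′ : ∀ x y → (x ⁻¹) ∙ (x ∙ y) ≡ y
  cancelˡ′ x y = trans (sym (assoc (x ⁻¹) x y)) (trans (cong (_∙ y) (inverseˡ x)) (identityˡ y))

  push-correct : ∀ {n} b (i : Fin n) w ρ → ⟦ push b i w ⟧ʷ ρ ≡ signed b (lookup ρ i) ∙ ⟦ w ⟧ʷ ρ
  push-correct b i [] ρ = refl
  push-correct true i ((false , j) ∷ w) ρ with i Fin.≟ j
  ... | yes refl = sym (cancelˡ _ _)
  ... | no _     = refl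
  push-correct false i ((true , j) ∷ w) ρ with i Fin.≟ j
  ... | yes refl = sym (cancelˡ′ _ _)
  ... | no _     = refl
  push-correct true i ((true , j) ∷ w) ρ = refl
  push-correct false i ((false , j) ∷ w) ρ = refl

  norm-correct : ∀ {n} b (e : Expr n) w ρ → ⟦ norm b e w ⟧ʷ ρ ≡ signed b (⟦ e ⟧ ρ) ∙ ⟦ w ⟧ʷ ρ
  norm-correct b (var i) w ρ = push-correct b i w ρ
  norm-correct true :ε w ρ = sym (identityˡ _)
  norm-correct false :ε w ρ = sym (trans (cong (_∙ ⟦ w ⟧ʷ ρ) ε⁻¹≈ε) (identityˡ _))
  norm-correct true (s :∙ t) w ρ =
    trans (norm-correct true s _ ρ) (trans (cong (_ ∙_) (norm-correct true t w ρ)) (sym (assoc _ _ _)))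
  norm-correct false (s :∙ t) w ρ =
    trans (norm-correct false t _ ρ) (trans (cong (_ ∙_) (norm-correct false s w ρ))
      (trans (sym (assoc _ _ _)) (cong (_∙ ⟦ w ⟧ʷ ρ) (sym (⁻¹-anti-homo-∙ _ _)))))
  norm-correct true (s :⁻¹) w ρ = norm-correct false s w ρ
  norm-correct false (s :⁻¹) w ρ = trans (norm-correct true s w ρ) (cong (_∙ ⟦ w ⟧ʷ ρ) (sym (⁻¹-involutive _)))

  open Relation.Binary.Reflection (Group.setoid group) var ⟦_⟧ (λ e → ⟦ norm true e [] ⟧ʷ)
    (λ e ρ → trans (norm-correct true e [] ρ) (identityʳ _)) public using (solve; _⊜_)

  infixl 8 _:^_

  _:^_ : ∀ {n} → Expr n → Expr n → Expr n
  u :^ c = c :⁻¹ :∙ u :∙ c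

  :[_,_] : ∀ {n} → Expr n → Expr n → Expr n
  :[ u , c ] = u :⁻¹ :∙ c :⁻¹ :∙ u :∙ c

-- Eventual properties.

Ev : (𝓕ℕ → Set) → Set
Ev V = ∃[ n ] (∀ α → n < minF α → V α)

-- Keeping only the maximum of the bounding set lets bounds be combined by `_⊔_`.
InE⇒Ev : ∀ {V} → InE V → Ev V
InE⇒Ev (β , h) = maxF β , h

Ev-× : ∀ {V V′} → Ev V → Ev V′ → Ev (λ α → V α × V′ α)
Ev-× (m , h) (n , k) = m ⊔ n , λ α p → h α (≤-<-trans (m≤m⊔n m n) p) , k α (≤-<-trans (m≤n⊔m m n) p)

Ev-map : ∀ {V V′} → (∀ α → V α → V′ α) → Ev V → Ev V′
Ev-map f (n , h) = n , λ α p → f α (h α p)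

Ev-above : ∀ n → Ev (λ α → n < minF α)
Ev-above n = n , λ _ p → p

-- The lower central series.

module LowerCentral {G : Set} (op : G → G → G) (e : G) (inv : G → G) (isGroup : IsGroup _≡_ op e inv) where

  open GroupSolver op e inv isGroup public
  open GroupNotions op e inv public

  γ-ε : ∀ i → γ i ε
  γ-ε zero    = γ-all _
  γ-ε (suc i) = γ-one

  γ-∙ : ∀ i {x y} → γ i x → γ i y → γ i (x ∙ y)
  γ-∙ zero    _ _ = γ-all _
  γ-∙ (suc i) p q = γ-mul p q

  γ-⁻¹ : ∀ i {x} → γ i x → γ i (x ⁻¹)
  γ-⁻¹ zero    _ = γ-all _
  γ-⁻¹ (suc i) p = γ-inv p

  γ-pred : ∀ {i x} → γ (suc i) x → γ i x
  γ-pred {zero} _ = γ-all _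
  γ-pred {suc i} (γ-gen g p) = γ-gen g (γ-pred p)
  γ-pred {suc i} γ-one       = γ-one
  γ-pred {suc i} (γ-mul p q) = γ-mul (γ-pred p) (γ-pred q)
  γ-pred {suc i} (γ-inv p)   = γ-inv (γ-pred p)

  γ-anti : ∀ {i j x} → i ≤ j → γ j x → γ i x
  γ-anti {i} {zero} z≤n p = p
  γ-anti {i} {suc j} le p with m≤n⇒m<n∨m≡n le
  ... | inj₁ lt   = γ-anti (s≤s⁻¹ lt) (γ-pred p)
  ... | inj₂ refl = p

  γ-conj : ∀ {i x} g → γ i x → γ i (x ^ g)
  γ-conj {i} {x} g p = subst (γ i) (solve 2 (λ x g → x :∙ :[ x , g ] ⊜ x :^ g) refl x g)
    (γ-∙ i p (γ-pred (γ-gen g p)))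

  -- The inductive step is the Hall–Witt identity for x, z, g⁻¹.
  γ-comm : ∀ j {i x y} → γ i x → γ j y → γ (suc (j + i)) [ x , y ]
  γ-comm zero p (γ-all g) = γ-gen g p
  γ-comm (suc j) {i} {x} p (γ-gen {x = z} g q) =
    subst (γ (suc (suc j + i)))
      (solve 3 (λ x z g → (((:[ :[ x , z :⁻¹ ] , g :⁻¹ ] :^ z) :⁻¹ :∙
                            (:[ :[ x :⁻¹ , g :⁻¹ ] :⁻¹ , z ] :^ x) :⁻¹) :^ g) :⁻¹ ⊜ :[ x , :[ z , g ] ]) refl x z g)
      (γ-inv (γ-conj g (γ-mul
        (γ-inv (γ-conj z (γ-gen (g ⁻¹) (γ-comm j p (γ-⁻¹ j q)))))
        (γ-inv (γ-conj x (γ-anti (≤-reflexive (cong suc (sym (+-suc j i))))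
          (γ-comm j (γ-inv (γ-gen (g ⁻¹) (γ-⁻¹ i p))) q)))))))
  γ-comm (suc j) {i} {x} p γ-one = subst (γ _) (solve 1 (λ x → :ε ⊜ :[ x , :ε ]) refl x) γ-one
  γ-comm (suc j) {i} {x} p (γ-mul {x = y} {y = y′} q q′) =
    subst (γ _) (solve 3 (λ x y y′ → :[ x , y′ ] :∙ :[ x , y ] :^ y′ ⊜ :[ x , y :∙ y′ ]) refl x y y′)
      (γ-mul (γ-comm (suc j) p q′) (γ-conj y′ (γ-comm (suc j) p q)))
  γ-comm (suc j) {i} {x} p (γ-inv {x = y} q) =
    subst (γ _) (solve 2 (λ x y → (:[ x , y ] :^ (y :⁻¹)) :⁻¹ ⊜ :[ x , y :⁻¹ ]) refl x y)
      (γ-inv (γ-conj (y ⁻¹) (γ-comm (suc j) p q)))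

-- The weight filtration on maps.

module Polynomials {G : Set} (op : G → G → G) (e : G) (inv : G → G) (isGroup : IsGroup _≡_ op e inv) (d′ : ℕ) where

  open LowerCentral op e inv isGroup public

  Fun : Set
  Fun = 𝓕ℕ → G

  d : ℕ
  d = suc d′

  -- The lower central series with every term repeated d times: γ a for a d < t ≤ (a + 1) d.
  Gr : ℕ → G → Set
  Gr t x = ∀ a → d * a < t → γ a x

  -- Only `a = 0` satisfies `d * a < t`. Hence arbitrary values of polynomials may enter `W` as
  -- constants of weight up to `d`.
  Gr-all : ∀ {t} x → t ≤ d → Gr t x
  Gr-all x le zero    _  = γ-all x
  Gr-all x le (suc a) lt with () ← <-irrefl refl (≤-<-trans (m≤m*n d (suc a)) (<-≤-trans lt le))

  private
    <d*suc[/d] : ∀ s → s < d * suc (s / d)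
    <d*suc[/d] s = subst (s <_) (*-comm (suc (s / d)) d)
      (subst (_< suc (s / d) * d) (sym (m≡m%n+[m/n]*n s d)) (+-monoˡ-< (s / d * d) (m%n<n s d)))

    d*[/d]< : ∀ s → d * (s / d) < suc s
    d*[/d]< s = s≤s (subst (_≤ s) (*-comm (s / d) d) (m/n*n≤m s d))

  -- A positive weight `suc s` gives the term `s / d`. The rounding costs at most one term in the
  -- sum, which is the extra one that `γ-comm` supplies. If one weight is zero, normality of the
  -- terms suffices.
  Gr-comm : ∀ s t {x y} → Gr s x → Gr t y → Gr (s + t) [ x , y ]
  Gr-comm zero t {x} {y} p q a lt =
    subst (γ a) (solve 2 (λ x y → (y :⁻¹) :^ x :∙ y ⊜ :[ x , y ]) refl x y)
      (γ-∙ a (γ-conj x (γ-⁻¹ a (q a lt))) (q a lt))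
  Gr-comm (suc s) zero {x} {y} p q a lt =
    subst (γ a) (solve 2 (λ x y → x :⁻¹ :∙ x :^ y ⊜ :[ x , y ]) refl x y)
      (γ-∙ a (γ-⁻¹ a (p a lt′)) (γ-conj y (p a lt′)))
    where lt′ = subst (d * a <_) (+-identityʳ (suc s)) lt
  Gr-comm (suc s) (suc t) {x} {y} p q a lt =
    γ-anti a≤ (γ-comm (t / d) (p (s / d) (d*[/d]< s)) (q (t / d) (d*[/d]< t)))
    where
    a≤ : a ≤ suc (t / d + s / d)
    a≤ = subst (a ≤_) (cong suc (+-comm (s / d) (t / d))) (s≤s⁻¹ (subst (a <_) (cong suc (+-suc (s / d) (t / d)))
      (*-cancelˡ-< d a (suc (s / d) + suc (t / d)) (<-≤-trans lt
        (≤-trans (+-mono-≤ (<d*suc[/d] s) (<d*suc[/d] t)) (≤-reflexive (sym (*-distribˡ-+ d (suc (s / d)) (suc (t / d))))))))))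

  shift : 𝓕ℕ → Maybe 𝓕ℕ → Maybe 𝓕ℕ
  shift β nothing  = just β
  shift β (just α) = just (α ∪F β)

  ext : Fun → Maybe 𝓕ℕ → G
  ext R = maybe R ε

  -- nothing stands for ∅, where the given polynomials are extended by ε.
  data W : ℕ → (Maybe 𝓕ℕ → G) → Set where
    atom : ∀ {n t R} → PolyDeg n R → n + suc t ≤ d → W t (ext R)
    cst  : ∀ {t c} → Gr t c → W t (λ _ → c)
    mul  : ∀ {t H K} → W t H → W t K → W t (λ p → H p ∙ K p)
    inve : ∀ {t H} → W t H → W t (λ p → H p ⁻¹)
    comm : ∀ {s t H K} → W s H → W t K → W (s + t) (λ p → [ H p , K p ])
    weak : ∀ {s t H} → s ≤ t → W t H → W s H
    cong-ae : ∀ {t H K} → H nothing ≡ K nothing → Ev (λ α → H (just α) ≡ K (just α)) → W t H → W t K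

  W-cong : ∀ {t H K} → (∀ p → H p ≡ K p) → W t H → W t K
  W-cong eq = cong-ae (eq nothing) (0 , λ α _ → eq (just α))

  W-conj : ∀ {s t H K} → W t H → W s K → W t (λ p → H p ^ K p)
  W-conj {s} {t} {H} {K} h k =
    W-cong (λ p → solve 2 (λ x g → x :∙ :[ x , g ] ⊜ x :^ g) refl (H p) (K p))
      (mul h (weak (m≤m+n t s) (comm h k)))

  -- Evaluation at ∅ is a homomorphism that sends atoms to `ε`, so only constants contribute. The
  -- equality at `nothing` carried by `cong-ae` is used here.
  W-value : ∀ {t H} → W t H → Gr t (H nothing)
  W-value (atom _ _) a lt = γ-ε a
  W-value (cst g) = g
  W-value (mul h k) a lt = γ-∙ a (W-value h a lt) (W-value k a lt)
  W-value (inve h) a lt = γ-⁻¹ a (W-value h a lt)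
  W-value (comm {s} {t} h k) = Gr-comm s t (W-value h) (W-value k)
  W-value (weak le h) a lt = W-value h a (<-≤-trans lt le)
  W-value (cong-ae eq _ h) a lt = subst (γ a) eq (W-value h a lt)

  W-∂ : ∀ {t H} → W t H → Ev (λ β → W (suc t) (λ p → H (shift β p) ∙ H p ⁻¹))
  W-∂ {t} (atom {zero} {R = R} (x , ip , ae) le) with InE⇒Ev ae
  ... | n , eq = n , λ β n<β → cong-ae (solve 1 (λ r → r ⊜ r :∙ :ε :⁻¹) refl (R β))
      (Ev-map (λ α (β≺α , n<α) → sym (begin
        R (α ∪F β) ∙ R α ⁻¹   ≡⟨ cong₂ (λ u v → u ∙ v ⁻¹) (eq (α ∪F β) (subst (n <_) (sym (minF-∪F {β} {α} β≺α)) n<β)) (eq α n<α) ⟩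
        x (α ∪F β) ∙ x α ⁻¹   ≡⟨ cong (λ u → x u ∙ x α ⁻¹) (∪F-comm {β} {α} β≺α) ⟩
        x (β ∪F α) ∙ x α ⁻¹   ≡⟨ cong (_∙ x α ⁻¹) (ip β α β≺α) ⟩
        (x β ∙ x α) ∙ x α ⁻¹  ≡⟨ solve 2 (λ u v → u :∙ v :∙ v :⁻¹ ⊜ u) refl (x β) (x α) ⟩
        x β                   ≡⟨ sym (eq β n<β) ⟩
        R β                   ∎)) (Ev-× (Ev-above (maxF β)) (Ev-above n)))
      (cst (Gr-all (R β) le))
    where open ≡-Reasoning
  W-∂ {t} (atom {suc n} {R = R} pd le) = Ev-map
    (λ β pdβ → W-cong (λ { nothing → solve 1 (λ r → (:ε :∙ r) :^ (:ε :⁻¹) ⊜ r :∙ :ε :⁻¹) refl (R β)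
                         ; (just α) → solve 3 (λ r u b → ((r :⁻¹ :∙ u :∙ b :⁻¹) :∙ b) :^ (r :⁻¹) ⊜ u :∙ r :⁻¹) refl (R α) (R (α ∪F β)) (R β) })
      (W-conj (mul (atom pdβ le′) (cst (Gr-all (R β) (≤-trans (n≤1+n (suc t)) (≤-trans (m≤n+m (suc (suc t)) n) le′))))) (inve (atom {suc n} {t} {R} pd le))))
    (InE⇒Ev pd)
    where le′ : n + suc (suc t) ≤ d
          le′ = subst (_≤ d) (sym (+-suc n (suc t))) le
  W-∂ {t} (cst {c = c} g) = 0 , λ β _ → W-cong (λ _ → sym (inverseʳ c)) (cst (λ a _ → γ-ε a))
  W-∂ (mul {H = H} {K} h k) = Ev-map (λ β (a , b) →
      W-cong (λ p → solve 4 (λ h h′ k k′ → (h′ :∙ h :⁻¹) :∙ (k′ :∙ k :⁻¹) :^ (h :⁻¹) ⊜ (h′ :∙ k′) :∙ (h :∙ k) :⁻¹) refl (H p) (H (shift β p)) (K p) (K (shift β p)))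
        (mul a (W-conj b (inve h))))
    (Ev-× (W-∂ h) (W-∂ k))
  W-∂ (inve {H = H} h) = Ev-map (λ β a →
      W-cong (λ p → solve 2 (λ h h′ → ((h′ :∙ h :⁻¹) :⁻¹) :^ h ⊜ h′ :⁻¹ :∙ h :⁻¹ :⁻¹) refl (H p) (H (shift β p)))
        (W-conj (inve a) h))
    (W-∂ h)
  -- Each of the two factors contains exactly one commutator with a difference, which supplies the
  -- additional weight.
  W-∂ (comm {s} {t} {H} {K} h k) = Ev-map (λ β (a , b) →
      W-cong (λ p → solve 4 (λ h h′ k k′ →
          (:[ h′ :∙ h :⁻¹ , (k′ :∙ k :⁻¹) :∙ k ] :^ h) :∙ ((:[ h , k′ :∙ k :⁻¹ ] :^ k) :^ (:[ h , k ] :⁻¹))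
            ⊜ :[ h′ , k′ ] :∙ :[ h , k ] :⁻¹) refl (H p) (H (shift β p)) (K p) (K (shift β p)))
        (mul (W-conj (comm a (mul (weak (n≤1+n t) b) k)) h)
             (W-conj (W-conj (weak (≤-reflexive (sym (+-suc s t))) (comm h b)) k) (inve (comm h k)))))
    (Ev-× (W-∂ h) (W-∂ k))
  W-∂ (weak le h) = Ev-map (λ β → weak (s≤s le)) (W-∂ h)
  W-∂ (cong-ae {H = H} {K} eq (n , eqs) h) = Ev-map (λ β (n<β , w) →
      cong-ae (cong₂ (λ u v → u ∙ v ⁻¹) (eqs β n<β) eq)
        (Ev-map (λ α (β≺α , n<α) → cong₂ (λ u v → u ∙ v ⁻¹)
            (eqs (α ∪F β) (subst (n <_) (sym (minF-∪F {β} {α} β≺α)) n<β)) (eqs α n<α))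
          (Ev-× (Ev-above (maxF β)) (Ev-above n))) w)
    (Ev-× (Ev-above n) (W-∂ h))

  V : ℕ → Fun → Set
  V t R = W t (ext R)

  V-cong : ∀ {t R S} → Ev (λ α → R α ≡ S α) → V t R → V t S
  V-cong eq = cong-ae refl eq

  V-≗ : ∀ {t R S} → (∀ α → R α ≡ S α) → V t R → V t S
  V-≗ eq = V-cong (0 , λ α _ → eq α)

  V-ε : ∀ {t} → V t (λ _ → ε)
  V-ε = W-cong (λ { nothing → refl ; (just _) → refl }) (cst (λ a _ → γ-ε a))

  V-∙ : ∀ {t R S} → V t R → V t S → V t (λ α → R α ∙ S α)
  V-∙ r s = W-cong (λ { nothing → identityˡ ε ; (just _) → refl }) (mul r s)

  V-⁻¹ : ∀ {t R} → V t R → V t (λ α → R α ⁻¹)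
  V-⁻¹ r = W-cong (λ { nothing → ε⁻¹≈ε ; (just _) → refl }) (inve r)

  -- As `d` is positive, every constant has weight one; this is why conjugation by a constant acts
  -- trivially on the quotients.
  cst₁ : ∀ c → W 1 (λ _ → c)
  cst₁ c = cst (Gr-all c (s≤s z≤n))

  V-conj : ∀ {t R} c → V t R → V (suc t) (λ α → R α ^ c ∙ R α ⁻¹)
  V-conj {t} {R} c r = W-cong
    (λ { nothing → solve 1 (λ c → :[ c , :ε :⁻¹ ] ⊜ :ε) refl c
       ; (just α) → solve 2 (λ c r → :[ c , r :⁻¹ ] ⊜ (r :^ c) :∙ r :⁻¹) refl c (R α) })
    (comm (cst₁ c) (inve r))

  -- By `W-∂` the translate differs from `R` by weight `t + 1`. At ∅ this difference is `R β`, so by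
  -- `W-value` the constant `R β` has weight `t + 1` too and may be divided out.
  V-shift : ∀ {t R} → V t R → Ev (λ β → ∀ c → V (suc t) (λ α → (R (α ∪F β) ∙ R β ⁻¹) ^ c ∙ R α ⁻¹))
  V-shift {t} {R} r = Ev-map (λ β a c → W-cong
      (λ { nothing → solve 2 (λ c b → (((b :∙ :ε :⁻¹) :∙ ((b :∙ :ε :⁻¹) :⁻¹) :^ (:ε :⁻¹)) :^ c) :∙ :[ c , :ε :⁻¹ ] ⊜ :ε) refl c (R β)
         ; (just α) → solve 4 (λ c b r u → (((u :∙ r :⁻¹) :∙ ((b :∙ :ε :⁻¹) :⁻¹) :^ (r :⁻¹)) :^ c) :∙ :[ c , r :⁻¹ ]
                          ⊜ ((u :∙ b :⁻¹) :^ c) :∙ r :⁻¹) refl c (R β) (R α) (R (α ∪F β)) })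
      (mul (W-conj (mul a (W-conj (inve (cst (W-value a))) (inve r))) (cst₁ c)) (comm (cst₁ c) (inve r))))
    (W-∂ r)

  -- `R β` is the value at ∅ of the difference under translation by `β`. This has weight `t + 1`,
  -- which exceeds `d * c`, so the value lies in `γ c`.
  V-trivial : ∀ {t R} c → (∀ x → γ c x → x ≡ ε) → d * c ≤ t → V t R → Ev (λ α → R α ≡ ε)
  V-trivial {R = R} c nil le r = Ev-map (λ β a →
      trans (solve 1 (λ x → x ⊜ x :∙ :ε :⁻¹) refl (R β)) (nil _ (W-value a c (s≤s le))))
    (W-∂ r)

-- Finite index types.

Finite : Set → Set
Finite J = Σ (List J) λ xs → ∀ j → j ∈ xs

private variable I J : Set

finite-⊥ : Finite ⊥
finite-⊥ = [] , λ ()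

finite-⊤ : Finite ⊤
finite-⊤ = tt ∷ [] , λ _ → here refl

finite-T : ∀ b → Finite (True b)
finite-T true  = finite-⊤
finite-T false = finite-⊥

finite-Fin : ∀ n → Finite (Fin n)
finite-Fin n = allFin n , ∈-allFin

finite-Maybe : Finite I → Finite (Maybe I)
finite-Maybe (xs , p) = nothing ∷ map just xs , λ { nothing → here refl ; (just i) → there (∈-map⁺ just (p i)) }

finite-⊎ : Finite I → Finite J → Finite (I ⊎ J)
finite-⊎ (xs , p) (ys , q) = map inj₁ xs ++ map inj₂ ys ,
  λ { (inj₁ i) → ∈-++⁺ˡ (∈-map⁺ inj₁ (p i)) ; (inj₂ j) → ∈-++⁺ʳ (map inj₁ xs) (∈-map⁺ inj₂ (q j)) }

finite-Σ : ∀ {J : I → Set} → Finite I → (∀ i → Finite (J i)) → Finite (Σ I J)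
finite-Σ (xs , p) f = concatMap (λ i → map (i ,_) (proj₁ (f i))) xs ,
  λ { (i , j) → ∈-concatMap⁺ (λ i → map (i ,_) (proj₁ (f i))) (lose (p i) (∈-map⁺ (i ,_) (proj₂ (f i) j))) }

finite-× : Finite I → Finite J → Finite (I × J)
finite-× f g = finite-Σ f (λ _ → g)

finite-Vec : ∀ n → Finite I → Finite (Vec I n)
finite-Vec zero    f = []ⱽ ∷ [] , λ { []ⱽ → here refl }
finite-Vec (suc n) f = cartesianProductWith _∷ⱽ_ (proj₁ f) (proj₁ (finite-Vec n f)) ,
  λ { (x ∷ⱽ v) → ∈-cartesianProductWith⁺ _∷ⱽ_ (proj₂ f x) (proj₂ (finite-Vec n f) v) }

-- Replaces a case distinction on an existential statement when neither predicate is decidable.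
search : ∀ {P Q : J → Set} → Finite J → (∀ j → P j ⊎ Q j) → (∃[ j ] P j) ⊎ (∀ j → Q j)
search {J} {P} {Q} (xs , c) h with go xs
  where
  go : ∀ ys → (∃[ j ] P j) ⊎ (∀ j → j ∈ ys → Q j)
  go [] = inj₂ λ _ ()
  go (y ∷ ys) with h y | go ys
  ... | inj₁ p | _      = inj₁ (y , p)
  ... | _      | inj₁ p = inj₁ p
  ... | inj₂ q | inj₂ r = inj₂ λ { _ (here refl) → q ; j (there m) → r j m }
... | inj₁ p = inj₁ p
... | inj₂ r = inj₂ λ j → r j (c j)

-- Enumerations may repeat elements; the position chosen by the membership proof still yields
-- decidable equality and the pigeonhole principle.
index : (f : Finite I) → I → Fin (length (proj₁ f))
index (_ , p) i = Any.index (p i)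

index-injective : (f : Finite I) → ∀ {i j} → index f i ≡ index f j → i ≡ j
index-injective (xs , p) {i} {j} eq =
  trans (Any.lookup-index (p i)) (trans (cong (lookupᴸ xs) eq) (sym (Any.lookup-index (p j))))

finite-≟ : Finite I → (i j : I) → Dec (i ≡ j)
finite-≟ f i j with index f i Fin.≟ index f j
... | yes eq = yes (index-injective f eq)
... | no ne  = no λ { refl → ne refl }

vec-repeats : (f : Finite I) (v : Vec I (suc (length (proj₁ f)))) → ¬ (∀ i j → lookup v i ≡ lookup v j → i ≡ j)
vec-repeats f v inj with Fin.pigeonhole (n<1+n _) (λ i → index f (lookup v i))
... | i , j , i<j , eq = Fin.<⇒≢ i<j (inj i j (index-injective f eq))

Ev-∀ : ∀ {V : J → 𝓕ℕ → Set} → Finite J → (∀ j → Ev (V j)) → Ev (λ α → ∀ j → V j α)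
Ev-∀ {J} {V} (xs , c) h = Ev-map (λ α k j → k j (c j)) (go xs)
  where
  go : ∀ ys → Ev (λ α → ∀ j → j ∈ ys → V j α)
  go [] = 0 , λ _ _ _ ()
  go (y ∷ ys) = Ev-map (λ { α (p , q) _ (here refl) → p ; α (p , q) j (there m) → q j m }) (Ev-× (h y) (go ys))

split : ∀ {A : Set} {P : A → Set} {x xs} → Any P (x ∷ xs) → P x ⊎ Any P xs
split (here p)  = inj₁ p
split (there p) = inj₂ p

-- Boolean tags make the indices with a given outcome into a finite type, through `finite-T`.
isLeft isRight : ∀ {P Q : Set} → P ⊎ Q → Bool
isLeft (inj₁ _) = true
isLeft (inj₂ _) = false
isRight (inj₁ _) = false
isRight (inj₂ _) = true

fromLeft : ∀ {P Q : Set} (x : P ⊎ Q) → True (isLeft x) → P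
fromLeft (inj₁ p) _ = p

fromRight : ∀ {P Q : Set} (x : P ⊎ Q) → True (isRight x) → Q
fromRight (inj₂ q) _ = q

-- Unions with the sets of a chain; index zero stands for ∅, which has no code.

un : ∀ {n} → (Fin n → 𝓕ℕ) → Fin (suc n) → 𝓕ℕ → 𝓕ℕ
un B zero    α = α
un B (suc j) α = α ∪F B j

Beyond : ∀ {n} → (Fin n → 𝓕ℕ) → Fin (suc n) → 𝓕ℕ → Set
Beyond B zero    α = ⊤
Beyond B (suc j) α = B j ≺ α

un-∪F : ∀ {n} (B : Fin n → 𝓕ℕ) j {β α} → Beyond B j β → β ≺ α → un B j (α ∪F β) ≡ α ∪F un B j β
un-∪F B zero    _ _ = refl
un-∪F B (suc j) {β} {α} p q = sym (∪F-assoc {B j} {β} {α} p q)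

≺-un : ∀ {n} (B : Fin n → 𝓕ℕ) j {β α} → Beyond B j β → un B j β ≺ α → β ≺ α
≺-un B zero    _ q = q
≺-un B (suc j) {β} {α} p q = subst (_< minF α) (maxF-∪F {B j} {β} p) q

Beyond-∪F : ∀ {n} (B : Fin n → 𝓕ℕ) j {β α} → Beyond B j β → β ≺ α → Beyond B j (α ∪F β)
Beyond-∪F B zero    _ _ = tt
Beyond-∪F B (suc j) {β} {α} p q = subst (maxF (B j) <_) (sym (minF-∪F {β} {α} q)) p

un-above : ∀ {n b} (B : Fin n → 𝓕ℕ) j {β} → Beyond B j β → (∀ i → b < minF (B i)) → b < minF β → b < minF (un B j β)
un-above B zero    _ _ q = q
un-above {b = b} B (suc j) {β} p h q = subst (b <_) (sym (minF-∪F {B j} {β} p)) (h j)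

Ev-Beyond : ∀ {n} (B : Fin n → 𝓕ℕ) j → Ev (Beyond B j)
Ev-Beyond B zero    = 0 , λ _ _ → tt
Ev-Beyond B (suc j) = Ev-above (maxF (B j))

-- Systems, patterns and conjugation.

module Recurrence {G : Set} (op : G → G → G) (e : G) (inv : G → G) (isGroup : IsGroup _≡_ op e inv)
  (𝓕 : (G → Set) → Set) (isFilter : GroupNotions.IsFilter op e inv 𝓕) (idem : GroupNotions.Idempotent op e inv 𝓕)
  (𝒫 : (𝓕ℕ → G) → Set) (good : GroupNotions.GoodCollection op e inv 𝓕 𝒫)
  (inhabited : ∀ L → 𝓕 L → ∃[ g ] L g) (d′ : ℕ)
  (nilClass : ℕ) (nilpotent : ∀ x → GroupNotions.γ op e inv nilClass x → x ≡ e) where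

  open Polynomials op e inv isGroup d′ public
  open IsFilter isFilter
  open GoodCollection good

  𝓕-∀ : ∀ {J : Set} {B : J → Subset} → Finite J → (∀ j → 𝓕 (B j)) → 𝓕 (λ g → ∀ j → B j g)
  𝓕-∀ {J} {B} (xs , c) h = upward (go xs) (λ g k j → k j (c j))
    where
    go : ∀ ys → 𝓕 (λ g → ∀ j → j ∈ ys → B j g)
    go [] = upward (proj₂ nonempty) (λ _ _ _ ())
    go (y ∷ ys) = upward (inter (h y) (go ys)) (λ { g (p , q) _ (here refl) → p ; g (p , q) j (there m) → q j m })

  -- By idempotence `∂ L` is in `𝓕` whenever `L` is. Points are first kept in `∂ L` and brought into
  -- `L` by a later right translation.
  ∂ : Subset → Subset
  ∂ L g = 𝓕 (λ x → L (g ∙ x))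

  -- All points fn a (α) ∙ x of a pattern are kept in a prescribed 𝓕-set; only the base and the
  -- members indexed by M have to be monochromatic.
  record System : Set₁ where
    field
      base    : Fun
      𝒫-base  : 𝒫 base
      {A M}   : Set
      finA    : Finite A
      finM    : Finite M
      fn      : A → Fun
      𝒫-fn    : ∀ a → 𝒫 (fn a)
      mem     : M → A

  open System

  record Pattern (S : System) (L : Subset) (T : 𝓕ℕ → Set) : Set where
    constructor pattern-at
    field
      pos : 𝓕ℕ
      pt  : G
      far : T pos
      in-L : ∀ a → L (fn S a pos ∙ pt)

  open Pattern

  Mono : ∀ (S : System) {L T} {I : Set} → (I → G → Set) → Pattern S L T → Set
  Mono S Col p = ∃[ c ] (Col c (base S (pos p) ∙ pt p) × (∀ m → Col c (fn S (mem S m) (pos p) ∙ pt p)))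

  -- A colouring is a relation that need only be defined on the finitely many queried points, so
  -- that membership in sets of 𝓕 never has to be decided.
  record Unavoidable (S : System) (I : Set) (L : Subset) (T : 𝓕ℕ → Set) : Set₁ where
    field
      {Y Z} : Set
      finY  : Finite Y
      finZ  : Finite Z
      pat   : Y → Pattern S L T
      query : Z → Σ G L
      mono  : ∀ (Col : I → G → Set) → (∀ z → ∃[ c ] Col c (proj₁ (query z))) → ∃[ y ] Mono S Col (pat y)

  Recurrent : System → Set₁
  Recurrent S = ∀ {I} → Finite I → ∀ L → 𝓕 L → ∀ T → Ev T → Unavoidable S I L T

  conjBy : Fun → Fun → G → Fun
  conjBy N R z α = (R α ^ z) ∙ [ z , N α ]

  Conjugable : System → Subset
  Conjugable S z = ∀ a → 𝒫 (conjBy (base S) (fn S a) z)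

  𝓕-conjugable : ∀ S → 𝓕 (Conjugable S)
  𝓕-conjugable S = 𝓕-∀ (finA S) (λ a → condIII (fn S a) (base S) (𝒫-fn S a) (𝒫-base S))

  -- The field `in-L` does not speak of the base, so the base is added to the controlled functions
  -- as `nothing`.
  conjugates : ∀ S {J} → Finite J → (J → Σ G (Conjugable S)) → System
  conjugates S finJ z = record
    { base = base S ; 𝒫-base = 𝒫-base S
    ; finA = finite-Maybe (finite-× (finA S) finJ) ; finM = finite-× (finM S) finJ
    ; fn = λ { nothing → base S ; (just (a , j)) → conjBy (base S) (fn S a) (proj₁ (z j)) }
    ; 𝒫-fn = λ { nothing → 𝒫-base S ; (just (a , j)) → proj₂ (z j) a }
    ; mem = λ { (m , j) → just (mem S m , j) } }

  untwist : ∀ (N R : Fun) z α x → z ∙ (conjBy N R z α ∙ x) ≡ R α ∙ (N α ⁻¹ ∙ (z ∙ (N α ∙ x)))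
  untwist N R z α x = solve 4 (λ n r z x → z :∙ ((r :^ z) :∙ :[ z , n ] :∙ x) ⊜ r :∙ (n :⁻¹ :∙ (z :∙ (n :∙ x)))) refl (N α) (R α) z x

  untwist-base : ∀ (N : Fun) z α x → z ∙ (N α ∙ x) ≡ N α ∙ (N α ⁻¹ ∙ (z ∙ (N α ∙ x)))
  untwist-base N z α x = solve 3 (λ n z x → z :∙ (n :∙ x) ⊜ n :∙ (n :⁻¹ :∙ (z :∙ (n :∙ x)))) refl (N α) z x

  -- Several systems treated successively.

  module Family {I : Set} (finI : Finite I) {W : Set} (sys : W → System)
    (rec : ∀ w {J : Set} (finJ : Finite J) (z : J → Σ G (Conjugable (sys w))) → Recurrent (conjugates (sys w) finJ z))
    (Tw : W → 𝓕ℕ → Set) (evT : ∀ w → Ev (Tw w)) where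

    -- Each system has a colouring of its own, since a point may continue only some of the partial
    -- chains; `ColF` is the intended instance.
    record UnavoidableFamily (ws : List W) (L : Subset) (Lw : W → Subset) : Set₁ where
      field
        {Y Z} : Set
        finY  : Finite Y
        finZ  : Finite Z
        which : Y → W
        pat   : ∀ y → Pattern (sys (which y)) (Lw (which y)) (Tw (which y))
        query : Z → Σ G L
        mono  : ∀ (Col : W → I → G → Set) → (∀ z → Any (λ w → ∃[ c ] Col w c (proj₁ (query z))) ws) →
                ∃[ y ] Mono (sys (which y)) (Col (which y)) (pat y)

    module Extend (w : W) (ws : List W) (L : Subset) (Lw : W → Subset) where

      S = sys w
      N = base S

      L₂ : Subset
      L₂ z = Conjugable S z × ∂ L z × ∂ (Lw w) z

      module _ (fam : UnavoidableFamily ws L₂ (λ v → ∂ (Lw v))) where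

        private module F = UnavoidableFamily fam

        z· : F.Z → G
        z· z = proj₁ (F.query z)
        -- Points of the next pattern become right factors of the queries of `fam`, and its base
        -- point a right factor of the patterns of `fam`; these products have to stay in the
        -- prescribed sets.
        L₃ : Subset
        L₃ g = (∀ z → L (z· z ∙ g) × Lw w (z· z ∙ g)) ×
               (∀ y a → Lw (F.which y) ((fn (sys (F.which y)) a (pos (F.pat y)) ∙ pt (F.pat y)) ∙ g))
        FL₃ : 𝓕 L₃
        FL₃ = inter
          (𝓕-∀ F.finZ (λ z → inter (proj₁ (proj₂ (proj₂ (F.query z)))) (proj₂ (proj₂ (proj₂ (F.query z))))))
          (𝓕-∀ F.finY (λ y → 𝓕-∀ (finA (sys (F.which y))) (in-L (F.pat y))))

        conjSys : System
        conjSys = conjugates S F.finZ (λ z → z· z , proj₁ (proj₂ (F.query z)))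

        module _ (una : Unavoidable conjSys (Maybe (F.Z × I)) L₃ (Tw w)) where

          private module U = Unavoidable una

          focus : U.Y → G
          focus u = N (pos (U.pat u)) ∙ pt (U.pat u)
          which′ : U.Y × (F.Z ⊎ F.Y) → W
          which′ (u , inj₁ _) = w
          which′ (u , inj₂ y) = F.which y
          pat′ : ∀ y → Pattern (sys (which′ y)) (Lw (which′ y)) (Tw (which′ y))
          pat′ (u , inj₁ z) = pattern-at α (N α ⁻¹ ∙ (z· z ∙ (N α ∙ x))) (far (U.pat u))
            λ a → subst (Lw w) (untwist N (fn S a) (z· z) α x) (proj₂ (proj₁ (in-L (U.pat u) (just (a , z))) z))
            where α = pos (U.pat u)
                  x = pt (U.pat u)
          pat′ (u , inj₂ y) = pattern-at (pos (F.pat y)) (pt (F.pat y) ∙ focus u) (far (F.pat y))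
            λ a → subst (Lw (F.which y)) (assoc (fn (sys (F.which y)) a (pos (F.pat y))) (pt (F.pat y)) (focus u)) (proj₂ (in-L (U.pat u) nothing) y a)
          -- A point `g` receives `just (z , c)` if `z g` has colour `c` for `w`, and `nothing` if
          -- every `z g` is coloured for one of `ws`. In the first case untwisting by `z` gives a
          -- pattern for `w`. In the second all queries of `fam`, translated by the base point, are
          -- covered, which gives a pattern for a system of `ws`.
          mono′ : ∀ (Col : W → I → G → Set) →
            (∀ z → Any (λ w → ∃[ c ] Col w c (z· (proj₁ z) ∙ proj₁ (U.query (proj₂ z)))) (w ∷ ws)) →
            ∃[ y ] Mono (sys (which′ y)) (Col (which′ y)) (pat′ y)
          mono′ Col cover with U.mono Col′ cover′
            where
            Col′ : Maybe (F.Z × I) → G → Set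
            Col′ nothing g = ∀ z → Any (λ v → ∃[ c ] Col v c (z· z ∙ g)) ws
            Col′ (just (z , c)) g = Col w c (z· z ∙ g)
            cover′ : ∀ u → ∃[ c ] Col′ c (proj₁ (U.query u))
            cover′ u with search {P = λ z → ∃[ c ] Col w c (z· z ∙ proj₁ (U.query u))}
                            {Q = λ z → Any (λ v → ∃[ c ] Col v c (z· z ∙ proj₁ (U.query u))) ws}
                            F.finZ (λ z → split (cover (z , u)))
            ... | inj₁ (z , c , p) = just (z , c) , p
            ... | inj₂ q           = nothing , q
          ... | u , nothing , q , _ with F.mono (λ v c g → Col v c (g ∙ focus u)) q
          ...   | y , c , p , ps = (u , inj₂ y) , c ,
            subst (Col v c) (assoc (base (sys v) (pos (F.pat y))) (pt (F.pat y)) (focus u)) p ,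
            λ m → subst (Col v c) (assoc (fn (sys v) (mem (sys v) m) (pos (F.pat y))) (pt (F.pat y)) (focus u)) (ps m)
            where v = F.which y
          mono′ Col cover | u , just (z , c) , p , ps = (u , inj₁ z) , c ,
            subst (Col w c) (untwist-base N (z· z) (pos (U.pat u)) (pt (U.pat u))) p ,
            λ m → subst (Col w c) (untwist N (fn S (mem S m)) (z· z) (pos (U.pat u)) (pt (U.pat u))) (ps (m , z))

          extend : UnavoidableFamily (w ∷ ws) L Lw
          extend = record
            { Y = U.Y × (F.Z ⊎ F.Y) ; Z = F.Z × U.Z
            ; finY = finite-× U.finY (finite-⊎ F.finZ F.finY) ; finZ = finite-× F.finZ U.finZ
            ; which = which′ ; pat = pat′
            ; query = λ { (z , u) → z· z ∙ proj₁ (U.query u) , proj₁ (proj₁ (proj₂ (U.query u)) z) }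
            ; mono = mono′ }

    family : ∀ ws L → 𝓕 L → ∀ Lw → (∀ w → 𝓕 (Lw w)) → UnavoidableFamily ws L Lw
    -- With no systems left a single query suffices, since nothing can cover it.
    family [] L FL Lw FLw = record
      { finY = finite-⊥ ; finZ = finite-⊤ ; which = λ () ; pat = λ () ; query = λ _ → inhabited L FL
      ; mono = λ Col cover → ⊥-elim (Any.¬Any[] (cover tt)) }
    family (w ∷ ws) L FL Lw FLw = E.extend fam (rec w fin z (finite-Maybe (finite-× fin finI)) (E.L₃ fam) (E.FL₃ fam) (Tw w) (evT w))
      where
      module E = Extend w ws L Lw
      fam = family ws E.L₂ (inter (𝓕-conjugable (sys w)) (inter (idem L FL) (idem (Lw w) (FLw w))))
                   (λ v → ∂ (Lw v)) (λ v → idem (Lw v) (FLw v))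
      fin = UnavoidableFamily.finZ fam
      z : UnavoidableFamily.Z fam → Σ G (Conjugable (sys w))
      z i = proj₁ (UnavoidableFamily.query fam i) , proj₁ (proj₂ (UnavoidableFamily.query fam i))

  -- Classes of differences and the PET order.

  Class : Set
  Class = ℕ × Fun

  -- Levels never increase along the list, so the head is a class of highest level.
  data Classes : List Class → Set where
    []  : Classes []
    _∷_ : ∀ {l q cs} → V l q × All (λ c → proj₁ c ≤ l) cs → Classes cs → Classes ((l , q) ∷ cs)

  -- The pair (l , q) stands for the coset V (l + 1) q ⊆ V l.
  Fits : List Class → Fun → Set
  Fits cs h = Any (λ (l , q) → V (suc l) (λ α → h α ∙ q α ⁻¹)) cs

  V-absorb : ∀ {t} {h q : Fun} → V t (λ α → h α ∙ q α ⁻¹) → V t q → V t h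
  V-absorb {h = h} {q} v w = V-≗ (λ α → solve 2 (λ h q → h :∙ q :⁻¹ :∙ q ⊜ h) refl (h α) (q α)) (V-∙ v w)

  V-through : ∀ {t} (h′ h q : Fun) → V t (λ α → h′ α ∙ h α ⁻¹) → V t (λ α → h α ∙ q α ⁻¹) → V t (λ α → h′ α ∙ q α ⁻¹)
  V-through h′ h q v w =
    V-≗ (λ α → solve 3 (λ k h q → (k :∙ h :⁻¹) :∙ (h :∙ q :⁻¹) ⊜ k :∙ q :⁻¹) refl (h′ α) (h α) (q α)) (V-∙ v w)

  -- A coset of `V (suc l)` absorbs factors from `V (suc l)`. In this form invariance of the class
  -- under conjugation and translation follows at once from `V-conj` and `V-shift`.
  Fits-level : ∀ {cs h} → Classes cs → Fits cs h →
    ∃[ l ] (V l h × (∀ h′ → V (suc l) (λ α → h′ α ∙ h α ⁻¹) → Fits cs h′))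
  Fits-level {h = h} (_∷_ {l} {q} (v , _) _) (here w) =
    l , V-absorb (weak (n≤1+n l) w) v , λ h′ u → here (V-through h′ h q u w)
  Fits-level (_ ∷ cls) (there f) with Fits-level cls f
  ... | l , v , k = l , v , λ h′ u → there (k h′ u)

  Fits-≗ : ∀ {cs h h′} → (∀ α → h α ≡ h′ α) → Fits cs h → Fits cs h′
  Fits-≗ eq = Any.map (V-≗ (λ α → cong (_∙ _) (eq α)))

  Fits-conj : ∀ {cs h} → Classes cs → Fits cs h → ∀ c → Fits cs (λ α → h α ^ c)
  Fits-conj cls f c with Fits-level cls f
  ... | l , v , k = k _ (V-conj c v)

  Fits-shift : ∀ {cs h} → Classes cs → Fits cs h → Ev (λ β → ∀ c → Fits cs (λ α → (h (α ∪F β) ∙ h β ⁻¹) ^ c))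
  Fits-shift cls f with Fits-level cls f
  ... | l , v , k = Ev-map (λ β w c → k _ (w c)) (V-shift v)

  diff : (S : System) → M S → Fun
  diff S m α = fn S (mem S m) α ∙ base S α ⁻¹

  Fitted : List Class → System → Set
  Fitted cs S = ∀ m → Fits cs (diff S m)

  conjugates-fitted : ∀ {cs} → Classes cs → ∀ S → Fitted cs S →
    ∀ {J} (fin : Finite J) z → Fitted cs (conjugates S fin z)
  conjugates-fitted cls S fit fin z (m , j) =
    Fits-≗ (λ α → solve 3 (λ r n z → (r :∙ n :⁻¹) :^ z ⊜ (r :^ z) :∙ :[ z , n ] :∙ n :⁻¹) refl
                    (fn S (mem S m) α) (base S α) (proj₁ (z j)))
      (Fits-conj cls (fit m) (proj₁ (z j)))

  withBase : ∀ S N → 𝒫 N → System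
  withBase S N p = record { base = N ; 𝒫-base = p ; finA = finA S ; finM = finM S ; fn = fn S ; 𝒫-fn = 𝒫-fn S ; mem = mem S }

  prefix : ∀ {l cs} hs → All (V (suc l)) hs → All (λ c → proj₁ c ≤ l) cs → Classes cs →
    Classes (map (suc l ,_) hs ++ cs)
  prefix [] [] le cls = cls
  prefix {l} {cs} (h ∷ hs) (v ∷ vs) le cls =
    (v , All.++⁺ (All.map⁺ (All.universal (λ _ → ≤-refl) hs)) (All.map (λ p → ≤-trans p (n≤1+n l)) le)) ∷ prefix hs vs le cls

  Lowered : ℕ → List Class → System → Set
  Lowered l cs S = Σ Fun λ N → Σ (𝒫 N) λ p → Σ (List Fun) λ hs → Σ (List Class) λ cs′ →
    Classes cs′ × map proj₁ cs′ ≡ map (λ _ → suc l) hs ++ map proj₁ cs × Fitted cs′ (withBase S N p)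

  -- The new base is a member of the head class. Other members of that class differ from it by
  -- weight `l + 1`, and each opens a class of that level. The remaining classes are multiplied by
  -- the inverse of `h₀`, which has weight `l`, at least their level, so their levels persist. If
  -- nobody fits the head class, it is dropped and the base is kept.
  lower : ∀ {l q cs} → Classes ((l , q) ∷ cs) → ∀ S → Fitted ((l , q) ∷ cs) S → Lowered l cs S
  lower {l} {q} {cs} ((vq , le) ∷ cls) S fit with search (finM S) (λ m → split (fit m))
  ... | inj₂ tails = base S , 𝒫-base S , [] , cs , cls , refl , tails
  ... | inj₁ (m₀ , v₀) = fn S (mem S m₀) , 𝒫-fn S (mem S m₀) , hs , cs′ , classes , levels , fitted
    where
    h₀ : Fun
    h₀ = diff S m₀
    R₀ : Fun
    R₀ = fn S (mem S m₀)
    part : ∀ m → V (suc l) (λ α → diff S m α ∙ q α ⁻¹) ⊎ Fits cs (diff S m)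
    part m = split (fit m)
    heads : Finite (Σ (M S) λ m → True (isLeft (part m)))
    heads = finite-Σ (finM S) (λ m → finite-T (isLeft (part m)))
    rep : M S → Fun
    rep m α = fn S (mem S m) α ∙ R₀ α ⁻¹
    hs : List Fun
    hs = map (λ (m , _) → rep m) (proj₁ heads)
    move : Class → Class
    move (l′ , q′) = l′ , λ α → q′ α ∙ h₀ α ⁻¹
    cs′ : List Class
    cs′ = map (suc l ,_) hs ++ map move cs
    levels : map proj₁ cs′ ≡ map (λ _ → suc l) hs ++ map proj₁ cs
    levels = trans (map-++ proj₁ (map (suc l ,_) hs) (map move cs)) (cong₂ _++_ (sym (map-∘ hs)) (sym (map-∘ cs)))
    V-rep : ∀ m → True (isLeft (part m)) → V (suc l) (rep m)
    V-rep m t = V-≗ (λ α → solve 4 (λ r n r₀ q → (r :∙ n :⁻¹ :∙ q :⁻¹) :∙ (r₀ :∙ n :⁻¹ :∙ q :⁻¹) :⁻¹ ⊜ r :∙ r₀ :⁻¹) refl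
                         (fn S (mem S m) α) (base S α) (R₀ α) (q α))
                  (V-∙ (fromLeft (part m) t) (V-⁻¹ v₀))
    V-h₀ : V l h₀
    V-h₀ = V-absorb (weak (n≤1+n l) v₀) vq
    moved : ∀ {ds} → All (λ c → proj₁ c ≤ l) ds → Classes ds → Classes (map move ds)
    moved [] [] = []
    moved (p ∷ ps) ((v , le′) ∷ c) = (V-∙ v (V-⁻¹ (weak p V-h₀)) , All.map⁺ le′) ∷ moved ps c
    classes : Classes cs′
    classes = prefix hs (All.map⁺ (All.universal (λ (m , t) → V-rep m t) (proj₁ heads))) (All.map⁺ le) (moved le cls)
    fitted : Fitted cs′ (withBase S R₀ (𝒫-fn S (mem S m₀)))
    fitted m = go (part m) (λ t → Any.map⁺ (Any.map⁺ (lose (proj₂ heads (m , t)) trivial)))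
      where
      trivial : V (suc (suc l)) (λ α → rep m α ∙ rep m α ⁻¹)
      trivial = V-≗ (λ α → sym (inverseʳ (rep m α))) V-ε
      -- Abstracting from `part m` lets `isLeft` reduce in both cases.
      go : ∀ (x : V (suc l) (λ α → diff S m α ∙ q α ⁻¹) ⊎ Fits cs (diff S m)) →
           (True (isLeft x) → Fits (map (suc l ,_) hs) (rep m)) → Fits cs′ (rep m)
      go (inj₁ _) f = Any.++⁺ˡ (f tt)
      go (inj₂ w) f = Any.++⁺ʳ (map (suc l ,_) hs) (Any.map⁺ (Any.map
        (λ {c} → V-≗ (λ α → solve 4 (λ r n r₀ q → (r :∙ n :⁻¹) :∙ q :⁻¹ ⊜ (r :∙ r₀ :⁻¹) :∙ (q :∙ (r₀ :∙ n :⁻¹) :⁻¹) :⁻¹) refl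
                      (fn S (mem S m) α) (base S α) (R₀ α) (proj₂ c α))) w))

  -- Accessibility of the list of levels under the step: remove a class of highest level l and
  -- add any number of classes of level l + 1.
  data PET : List ℕ → Set where
    done : PET []
    triv : ∀ {l ls} → d * nilClass ≤ l → PET ls → PET (l ∷ ls)
    step : ∀ {l ls} → (∀ (hs : List Fun) → PET (map (λ _ → suc l) hs ++ ls)) → PET (l ∷ ls)

  -- Here `k` bounds the distance of `l` from the level where classes become trivial. The classes
  -- added at level `l + 1` are removed one by one with `k` decreased.
  PET-∷ : ∀ k {l ls} → d * nilClass ≤ k + l → PET ls → PET (l ∷ ls)
  PET-∷ zero le p = triv le p
  PET-∷ (suc k) {l} {ls} le p = step go
    where
    go : ∀ hs → PET (map (λ _ → suc l) hs ++ ls)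
    go []       = p
    go (h ∷ hs) = PET-∷ k (subst (d * nilClass ≤_) (sym (+-suc k l)) le) (go hs)

  PET-all : ∀ ls → PET ls
  PET-all []       = done
  PET-all (l ∷ ls) = PET-∷ (d * nilClass) (m≤m+n (d * nilClass) l) (PET-all ls)

  -- Colour focusing.

  module Focus (S : System) (cs : List Class) (cls : Classes cs) (fit : Fitted cs S)
    -- The induction hypothesis: a change of base after which all systems of conjugates are
    -- recurrent.
    (drop : ∀ S′ → Fitted cs S′ → Σ Fun λ N → Σ (𝒫 N) λ p → ∀ {J : Set} (fin : Finite J)
              (z : J → Σ G (Conjugable (withBase S′ N p))) → Recurrent (conjugates (withBase S′ N p) fin z)) where

    N₀ = base S

    Q : Fun → Fun
    Q R α = R α ∙ N₀ α ⁻¹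

    point : ∀ {n} → (Fin n → 𝓕ℕ) → G → Fin (suc n) → Fun → G
    point B f zero    R = f
    point B f (suc j) R = Q R (B j) ∙ f

    -- Focus f, with the j-th pattern at B j consisting of the points Q R (B j) ∙ f.  Index zero
    -- of ops stands for B = ∅, i.e. for the pattern that the next step creates.
    record State (n : ℕ) (L : Subset) (b : ℕ) : Set where
      field
        f      : G
        N      : Fun
        𝒫-N    : 𝒫 N
        B      : Fin n → 𝓕ℕ
        ops    : Fin (suc n) → Fun → Fun
        𝒫-ops  : ∀ j a → 𝒫 (ops j (fn S a))
        ops≡   : ∀ j R α → Beyond B j α → ops j R α ∙ N α ⁻¹ ≡ point B f j R ⁻¹ ∙ (Q R (un B j α) ∙ f)
        ops-fit : ∀ j m → Fits cs (λ α → ops j (fn S (mem S m)) α ∙ N α ⁻¹)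
        point-L : ∀ j a → ∂ L (point B f j (fn S a))
        f-L    : ∂ L f
        above  : ∀ j → b < minF (B j)

    open State

    system : ∀ {n L b} → State n L b → System
    system {n} s = record
      { base = N s ; 𝒫-base = 𝒫-N s
      ; finA = finite-Maybe (finite-× (finite-Fin (suc n)) (finA S))
      ; finM = finite-× (finite-Fin (suc n)) (finM S)
      ; fn = λ { nothing → N s ; (just (j , a)) → ops s j (fn S a) }
      ; 𝒫-fn = λ { nothing → 𝒫-N s ; (just (j , a)) → 𝒫-ops s j a }
      ; mem = λ { (j , m) → just (j , mem S m) } }

    system-fit : ∀ {n L b} (s : State n L b) → Fitted cs (system s)
    system-fit s (j , m) = ops-fit s j m

    initial : ∀ L → 𝓕 L → ∀ b → State 0 L b
    initial L FL b = record
      { f = ε ; N = N₀ ; 𝒫-N = 𝒫-base S ; B = λ () ; ops = λ _ R → R ; 𝒫-ops = λ _ a → 𝒫-fn S a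
      ; ops≡ = λ { zero R α _ → solve 2 (λ r n → r :∙ n :⁻¹ ⊜ :ε :⁻¹ :∙ ((r :∙ n :⁻¹) :∙ :ε)) refl (R α) (N₀ α) }
      ; ops-fit = λ _ m → fit m
      ; point-L = λ { zero _ → εL } ; f-L = εL ; above = λ () }
      where
      εL : ∂ L ε
      εL = upward FL (λ x p → subst L (sym (identityˡ x)) p)

    C₄ : ∀ {R P} → 𝒫 R → 𝒫 P → Subset
    C₄ r p = proj₁ (condIV _ _ r p)

    T₄ : ∀ {R P} → 𝒫 R → 𝒫 P → 𝓕ℕ → Set
    T₄ r p = proj₁ (proj₂ (proj₂ (condIV _ _ r p)))

    𝓕-C₄ : ∀ {R P} (r : 𝒫 R) (p : 𝒫 P) → 𝓕 (C₄ r p)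
    𝓕-C₄ r p = proj₁ (proj₂ (condIV _ _ r p))

    Ev-T₄ : ∀ {R P} (r : 𝒫 R) (p : 𝒫 P) → Ev (T₄ r p)
    Ev-T₄ r p = InE⇒Ev (proj₁ (proj₂ (proj₂ (proj₂ (condIV _ _ r p)))))

    𝒫-IV : ∀ {R P} (r : 𝒫 R) (p : 𝒫 P) {c β} → C₄ r p c → T₄ r p β → 𝒫 (λ α → (R α ∙ D β P α) ^ c)
    𝒫-IV r p = proj₂ (proj₂ (proj₂ (proj₂ (condIV _ _ r p)))) _ _

    module Step {n : ℕ} {L : Subset} {b : ℕ} (s : State n (∂ L) b) where

      -- As a right factor `g` keeps the points and the focus under control, and as a conjugator it
      -- is allowed in condition IV. Demanding everything of every point of the next pattern gives a
      -- single set of `𝓕`.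
      record Admissible (g : G) : Set where
        field
          point-ok : ∀ j a → ∂ L (point (B s) (f s) j (fn S a) ∙ g)
          f-ok     : ∂ L (f s ∙ g)
          N-C      : C₄ (𝒫-N s) (𝒫-N s) g
          ops-C    : ∀ j a → C₄ (𝒫-ops s j a) (𝒫-ops s j a) g
          fresh-C  : ∀ a → C₄ (𝒫-ops s zero a) (𝒫-N s) g

      record Far (β : 𝓕ℕ) : Set where
        field
          beyond  : ∀ j → Beyond (B s) j β
          N-T     : T₄ (𝒫-N s) (𝒫-N s) β
          ops-T   : ∀ j a → T₄ (𝒫-ops s j a) (𝒫-ops s j a) β
          fresh-T : ∀ a → T₄ (𝒫-ops s zero a) (𝒫-N s) β
          fits    : ∀ (i : Fin (suc n) × M S) c → let h = diff (system s) i in Fits cs (λ α → (h (α ∪F β) ∙ h β ⁻¹) ^ c)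
          high    : b < minF β

      𝓕-admissible : 𝓕 Admissible
      𝓕-admissible = upward
        (inter (𝓕-∀ (finite-Fin (suc n)) (λ j → 𝓕-∀ (finA S) (λ a → point-L s j a)))
        (inter (f-L s)
        (inter (𝓕-C₄ (𝒫-N s) (𝒫-N s))
        (inter (𝓕-∀ (finite-Fin (suc n)) (λ j → 𝓕-∀ (finA S) (λ a → 𝓕-C₄ (𝒫-ops s j a) (𝒫-ops s j a))))
               (𝓕-∀ (finA S) (λ a → 𝓕-C₄ (𝒫-ops s zero a) (𝒫-N s)))))))
        (λ g (p , q , r , t , u) → record { point-ok = p ; f-ok = q ; N-C = r ; ops-C = t ; fresh-C = u })

      Ev-far : Ev Far
      Ev-far = Ev-map
        (λ β (p , q , r , t , u , v) → record { beyond = p ; N-T = q ; ops-T = r ; fresh-T = t ; fits = u ; high = v })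
        (Ev-× (Ev-∀ (finite-Fin (suc n)) (Ev-Beyond (B s)))
        (Ev-× (Ev-T₄ (𝒫-N s) (𝒫-N s))
        (Ev-× (Ev-∀ (finite-Fin (suc n)) (λ j → Ev-∀ (finA S) (λ a → Ev-T₄ (𝒫-ops s j a) (𝒫-ops s j a))))
        (Ev-× (Ev-∀ (finA S) (λ a → Ev-T₄ (𝒫-ops s zero a) (𝒫-N s)))
        (Ev-× (Ev-∀ (finM (system s)) (λ i → Fits-shift cls (system-fit s i)))
              (Ev-above b))))))

      module Next (β : 𝓕ℕ) (x : G) (far : Far β) (adm : ∀ a → Admissible (fn (system s) a β ∙ x)) where
        open Far far
        open Admissible

        g₀ : G
        g₀ = N s β ∙ x

        f′ : G
        f′ = f s ∙ g₀

        N′ : Fun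
        N′ α = (N s α ∙ D β (N s) α) ^ g₀

        B′ : Fin (suc n) → 𝓕ℕ
        B′ j = un (B s) j β

        -- At index zero the derivative is that of the base and cancels in the quotient by `N′`,
        -- which is thus only conjugated and can still open a new pattern. At the other indices the
        -- function's own derivative translates the quotient by `β`.
        ops′ : Fin (suc (suc n)) → Fun → Fun
        ops′ zero    R α = (ops s zero R α ∙ D β (N s) α) ^ g₀
        ops′ (suc j) R α = (ops s j R α ∙ D β (ops s j R) α) ^ (ops s j R β ∙ x)

        -- This is the invariant `ops≡` read at `β`: a point of the new pattern, as right factor,
        -- moves the old point to the union with `β` and to the focus `f′`. For index zero the old
        -- point is the focus, which yields the fresh pattern at `β`.
        point′ : ∀ j R → point B′ f′ (suc j) R ≡ point (B s) (f s) j R ∙ (ops s j R β ∙ x)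
        point′ j R = begin
          q ∙ f′                        ≡⟨ solve 5 (λ p q f n x → q :∙ (f :∙ (n :∙ x)) ⊜ p :∙ ((p :⁻¹ :∙ (q :∙ f)) :∙ n :∙ x)) refl p q (f s) (N s β) x ⟩
          p ∙ ((p ⁻¹ ∙ (q ∙ f s)) ∙ N s β ∙ x) ≡⟨ cong (λ u → p ∙ (u ∙ N s β ∙ x)) (sym (ops≡ s j R β (beyond j))) ⟩
          p ∙ (r ∙ N s β ⁻¹ ∙ N s β ∙ x) ≡⟨ solve 4 (λ p r n x → p :∙ (r :∙ n :⁻¹ :∙ n :∙ x) ⊜ p :∙ (r :∙ x)) refl p r (N s β) x ⟩
          p ∙ (r ∙ x)                   ∎
          where
          open ≡-Reasoning
          p = point (B s) (f s) j R
          q = Q R (un (B s) j β)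
          r = ops s j R β

        ops≡′ : ∀ j R α → Beyond B′ j α → ops′ j R α ∙ N′ α ⁻¹ ≡ point B′ f′ j R ⁻¹ ∙ (Q R (un B′ j α) ∙ f′)
        ops≡′ zero R α _ = begin
          ops′ zero R α ∙ N′ α ⁻¹             ≡⟨ solve 4 (λ r n d g → ((r :∙ d) :^ g) :∙ ((n :∙ d) :^ g) :⁻¹ ⊜ (r :∙ n :⁻¹) :^ g) refl (ops s zero R α) (N s α) (D β (N s) α) g₀ ⟩
          (ops s zero R α ∙ N s α ⁻¹) ^ g₀    ≡⟨ cong (_^ g₀) (ops≡ s zero R α tt) ⟩
          (f s ⁻¹ ∙ (Q R α ∙ f s)) ^ g₀       ≡⟨ solve 3 (λ f q g → (f :⁻¹ :∙ (q :∙ f)) :^ g ⊜ (f :∙ g) :⁻¹ :∙ (q :∙ (f :∙ g))) refl (f s) (Q R α) g₀ ⟩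
          f′ ⁻¹ ∙ (Q R α ∙ f′)                ∎
          where open ≡-Reasoning
        ops≡′ (suc j) R α B′≺α = begin
          ops′ (suc j) R α ∙ N′ α ⁻¹
            ≡⟨ solve 7 (λ r r∪ rβ n n∪ nβ x → ((r :∙ (r :⁻¹ :∙ r∪ :∙ rβ :⁻¹)) :^ (rβ :∙ x)) :∙ ((n :∙ (n :⁻¹ :∙ n∪ :∙ nβ :⁻¹)) :^ (nβ :∙ x)) :⁻¹
                 ⊜ (rβ :∙ x) :⁻¹ :∙ (r∪ :∙ n∪ :⁻¹) :∙ (nβ :∙ x)) refl
                 (ops s j R α) (ops s j R (α ∪F β)) (ops s j R β) (N s α) (N s (α ∪F β)) (N s β) x ⟩
          (ops s j R β ∙ x) ⁻¹ ∙ (ops s j R (α ∪F β) ∙ N s (α ∪F β) ⁻¹) ∙ g₀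
            ≡⟨ cong (λ u → (ops s j R β ∙ x) ⁻¹ ∙ u ∙ g₀) (ops≡ s j R (α ∪F β) (Beyond-∪F (B s) j {β} {α} (beyond j) β≺α)) ⟩
          (ops s j R β ∙ x) ⁻¹ ∙ (p ⁻¹ ∙ (Q R (un (B s) j (α ∪F β)) ∙ f s)) ∙ g₀
            ≡⟨ cong (λ u → (ops s j R β ∙ x) ⁻¹ ∙ (p ⁻¹ ∙ (Q R u ∙ f s)) ∙ g₀) (un-∪F (B s) j {β} {α} (beyond j) β≺α) ⟩
          (ops s j R β ∙ x) ⁻¹ ∙ (p ⁻¹ ∙ (Q R (α ∪F B′ j) ∙ f s)) ∙ g₀
            ≡⟨ solve 5 (λ u p q f g → u :⁻¹ :∙ (p :⁻¹ :∙ (q :∙ f)) :∙ g ⊜ (p :∙ u) :⁻¹ :∙ (q :∙ (f :∙ g))) refl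
                 (ops s j R β ∙ x) p (Q R (α ∪F B′ j)) (f s) g₀ ⟩
          (p ∙ (ops s j R β ∙ x)) ⁻¹ ∙ (Q R (α ∪F B′ j) ∙ f′)
            ≡⟨ cong (λ u → u ⁻¹ ∙ (Q R (α ∪F B′ j) ∙ f′)) (sym (point′ j R)) ⟩
          point B′ f′ (suc j) R ⁻¹ ∙ (Q R (un B′ (suc j) α) ∙ f′) ∎
          where
          open ≡-Reasoning
          p = point (B s) (f s) j R
          β≺α : β ≺ α
          β≺α = ≺-un (B s) j {β} {α} (beyond j) B′≺α

        ops-fit′ : ∀ j m → Fits cs (λ α → ops′ j (fn S (mem S m)) α ∙ N′ α ⁻¹)
        ops-fit′ zero m = Fits-≗
          (λ α → solve 4 (λ r n d g → (r :∙ n :⁻¹) :^ g ⊜ ((r :∙ d) :^ g) :∙ ((n :∙ d) :^ g) :⁻¹) refl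
                   (ops s zero (fn S (mem S m)) α) (N s α) (D β (N s) α) g₀)
          (Fits-conj cls (ops-fit s zero m) g₀)
        ops-fit′ (suc j) m = Fits-≗
          (λ α → solve 7 (λ r r∪ rβ n n∪ nβ x →
                   ((r∪ :∙ n∪ :⁻¹) :∙ (rβ :∙ nβ :⁻¹) :⁻¹) :^ (rβ :∙ x)
                   ⊜ ((r :∙ (r :⁻¹ :∙ r∪ :∙ rβ :⁻¹)) :^ (rβ :∙ x)) :∙ ((n :∙ (n :⁻¹ :∙ n∪ :∙ nβ :⁻¹)) :^ (nβ :∙ x)) :⁻¹) refl
                   (R α) (R (α ∪F β)) (R β) (N s α) (N s (α ∪F β)) (N s β) x)
          (fits (j , m) (R β ∙ x))
          where R = ops s j (fn S (mem S m))

        next : State (suc n) L b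
        next = record
          { f = f′ ; N = N′ ; 𝒫-N = 𝒫-IV (𝒫-N s) (𝒫-N s) (N-C (adm nothing)) N-T ; B = B′ ; ops = ops′
          ; 𝒫-ops = λ { zero a → 𝒫-IV (𝒫-ops s zero a) (𝒫-N s) (fresh-C (adm nothing) a) (fresh-T a)
                      ; (suc j) a → 𝒫-IV (𝒫-ops s j a) (𝒫-ops s j a) (ops-C (adm (just (j , a))) j a) (ops-T j a) }
          ; ops≡ = ops≡′ ; ops-fit = ops-fit′
          ; point-L = λ { zero a → f-ok (adm nothing)
                        ; (suc j) a → subst (∂ L) (sym (point′ j (fn S a))) (point-ok (adm (just (j , a))) j a) }
          ; f-L = f-ok (adm nothing)
          ; above = λ j → un-above (B s) j (beyond j) (above s) high }

    Above : ℕ → 𝓕ℕ → Set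
    Above b α = b < minF α

    -- This choice of `pt` makes the focus the base point of the pattern.
    statePattern : ∀ {n L b} (s : State n L b) → Fin n → Pattern S (∂ L) (Above b)
    statePattern {L = L} s j = pattern-at (B s j) (N₀ (B s j) ⁻¹ ∙ f s) (above s j)
      (λ a → subst (∂ L) (assoc _ _ _) (point-L s (suc j) a))

    Distinct : ∀ {n L b} {I : Set} → State n L b → (I → G → Set) → Vec I (suc n) → Set
    Distinct s Col κ = (∀ i j → lookup κ i ≡ lookup κ j → i ≡ j) × Col (lookup κ zero) (f s) ×
      (∀ j m → Col (lookup κ j) (point (B s) (f s) j (fn S (mem S m))))

    statePattern-mono : ∀ {n L b} {I : Set} (s : State n L b) (Col : I → G → Set) j c → Col c (f s) →
      (∀ m → Col c (point (B s) (f s) (suc j) (fn S (mem S m)))) → Mono S Col (statePattern s j)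
    statePattern-mono s Col j c p q = c ,
      subst (Col c) (solve 2 (λ f n → f ⊜ n :∙ (n :⁻¹ :∙ f)) refl (f s) (N₀ (B s j))) p ,
      λ m → subst (Col c) (assoc _ _ _) (q m)

    -- A finite stock of chains: each colouring makes one of them distinct unless a monochromatic
    -- pattern occurs. With as many patterns as colours only the latter remains.
    record Chains (n : ℕ) (L : Subset) (b : ℕ) (I : Set) : Set₁ where
      field
        {Y X Z} : Set
        finY  : Finite Y
        finX  : Finite X
        finZ  : Finite Z
        pat   : Y → Pattern S (∂ L) (Above b)
        state : X → State n L b
        query : Z → Σ G (∂ L)
        found : ∀ (Col : I → G → Set) → (∀ z → ∃[ c ] Col c (proj₁ (query z))) →
                (∃[ y ] Mono S Col (pat y)) ⊎ (∃[ x ] ∃[ κ ] Distinct (state x) Col κ)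

    module Lengthen {I : Set} (finI : Finite I) {n : ℕ} {L : Subset} {b : ℕ} (chains : Chains n (∂ L) b I) where

      private module C = Chains chains

      rebased : C.X → System
      rebased i = withBase (system (C.state i)) (proj₁ t) (proj₁ (proj₂ t))
        where t = drop (system (C.state i)) (system-fit (C.state i))

      recurrent : ∀ i {J : Set} (fin : Finite J) (z : J → Σ G (Conjugable (rebased i))) → Recurrent (conjugates (rebased i) fin z)
      recurrent i = proj₂ (proj₂ (drop (system (C.state i)) (system-fit (C.state i))))

      open Family (finite-Vec (suc n) finI) rebased (λ i → recurrent i) (λ i → Step.Far {L = L} (C.state i)) (λ i → Step.Ev-far {L = L} (C.state i))

      Shifted : Subset
      Shifted g = (∀ z → ∂ L (proj₁ (C.query z) ∙ g)) × (∀ y a → ∂ L ((fn S a (pos (C.pat y)) ∙ pt (C.pat y)) ∙ g))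

      𝓕-Shifted : 𝓕 Shifted
      𝓕-Shifted = inter (𝓕-∀ C.finZ (λ z → proj₂ (C.query z))) (𝓕-∀ C.finY (λ y → 𝓕-∀ (finA S) (in-L (C.pat y))))

      module _ (fam : UnavoidableFamily (proj₁ C.finX) Shifted (λ i → Step.Admissible {L = L} (C.state i))) where

        private module F = UnavoidableFamily fam

        module Nx (y : F.Y) = Step.Next {L = L} (C.state (F.which y)) (pos (F.pat y)) (pt (F.pat y)) (far (F.pat y)) (in-L (F.pat y))

        newState : F.Y → State (suc n) L b
        newState y = Nx.next y

        g· : F.Z → G
        g· z = proj₁ (F.query z)

        newPat : (C.Y × F.Z) ⊎ (F.Y × Fin (suc n)) → Pattern S (∂ L) (Above b)
        newPat (inj₁ (y , z)) = pattern-at (pos (C.pat y)) (pt (C.pat y) ∙ g· z) (far (C.pat y))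
          (λ a → subst (∂ L) (assoc _ _ _) (proj₂ (proj₂ (F.query z)) y a))
        newPat (inj₂ (y , j)) = statePattern (newState y) j

        newQuery : (C.Z × F.Z) ⊎ F.Y → Σ G (∂ L)
        newQuery (inj₁ (z , z′)) = proj₁ (C.query z) ∙ g· z′ , proj₁ (proj₂ (F.query z′)) z
        newQuery (inj₂ y)        = f (newState y) , f-L (newState y)

        module _ (Col : I → G → Set) (cover : ∀ z → ∃[ c ] Col c (proj₁ (newQuery z))) where

          Result : Set
          Result = (∃[ y ] Mono S Col (newPat y)) ⊎ (∃[ y ] ∃[ κ ] Distinct (newState y) Col κ)

          Shift : G → I → G → Set
          Shift g c y = Col c (y ∙ g)

          -- A product colouring: the colour of `g` is the vector of colours of the whole chain
          -- translated by `g`. Constancy on a pattern makes the lengthened patterns monochromatic,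
          -- by `point′`.
          ColF : C.X → Vec I (suc n) → G → Set
          ColF i κ g = Distinct (C.state i) (Shift g) κ

          extended : ∀ y → Mono (rebased (F.which y)) (ColF (F.which y)) (F.pat y) → Result
          extended y (κ , (inj , _) , ps) = decide (cover (inj₂ y))
            where
            colours : ∀ j m → Col (lookup κ j) (point (B (newState y)) (f (newState y)) (suc j) (fn S (mem S m)))
            colours j m = subst (Col (lookup κ j)) (sym (Nx.point′ y j (fn S (mem S m)))) (proj₂ (proj₂ (ps (j , m))) j m)
            decide : ∃[ c ] Col c (f (newState y)) → Result
            -- If the focus has the colour of a pattern it completes that pattern; otherwise its
            -- colour is new and the chain grows.
            decide (c , p) with search {P = λ j → c ≡ lookup κ j} {Q = λ j → ¬ c ≡ lookup κ j} (finite-Fin (suc n))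
                                  (λ j → fromDec (finite-≟ finI c (lookup κ j)))
              where
              fromDec : ∀ {P : Set} → Dec P → P ⊎ ¬ P
              fromDec (yes q) = inj₁ q
              fromDec (no q)  = inj₂ q
            ... | inj₁ (j , refl) = inj₁ (inj₂ (y , j) , statePattern-mono (newState y) Col j c p (colours j))
            ... | inj₂ ne = inj₂ (y , c ∷ⱽ κ , inj′ , p , colours′)
              where
              inj′ : ∀ i j → lookup (c ∷ⱽ κ) i ≡ lookup (c ∷ⱽ κ) j → i ≡ j
              inj′ zero    zero    _  = refl
              inj′ zero    (suc j) eq = ⊥-elim (ne j eq)
              inj′ (suc i) zero    eq = ⊥-elim (ne i (sym eq))
              inj′ (suc i) (suc j) eq = cong suc (inj i j eq)
              colours′ : ∀ j m → Col (lookup (c ∷ⱽ κ) j) (point (B (newState y)) (f (newState y)) j (fn S (mem S m)))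
              colours′ zero    m = p
              colours′ (suc j) m = colours j m

          result : Result
          -- Each query of the family serves as a translation: it either carries an old pattern to a
          -- monochromatic one or leaves some chain distinct, and is then coloured for the system of
          -- that chain.
          result with search {P = λ z → ∃[ y ] Mono S (Shift (g· z)) (C.pat y)}
                             {Q = λ z → ∃[ i ] ∃[ κ ] ColF i κ (g· z)}
                             F.finZ (λ z → C.found (Shift (g· z)) (λ z′ → cover (inj₁ (z′ , z))))
          ... | inj₁ (z , y , c , p , ps) = inj₁ (inj₁ (y , z) , c , subst (Col c) (assoc _ _ _) p , λ m → subst (Col c) (assoc _ _ _) (ps m))
          ... | inj₂ h with F.mono ColF (λ z → lose (proj₂ C.finX (proj₁ (h z))) (proj₂ (h z)))
          ...   | y , q = extended y q

        lengthened : Chains (suc n) L b I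
        lengthened = record
          { finY = finite-⊎ (finite-× C.finY F.finZ) (finite-× F.finY (finite-Fin (suc n)))
          ; finX = F.finY ; finZ = finite-⊎ (finite-× C.finZ F.finZ) F.finY
          ; pat = newPat ; state = newState ; query = newQuery ; found = result }

      lengthen : Chains (suc n) L b I
      lengthen = lengthened (family (proj₁ C.finX) Shifted 𝓕-Shifted (λ i → Step.Admissible {L = L} (C.state i)) (λ i → Step.𝓕-admissible {L = L} (C.state i)))

    chains : ∀ {I} → Finite I → ∀ n L → 𝓕 L → ∀ b → Chains n L b I
    chains finI zero L FL b = record
      { finY = finite-⊥ ; finX = finite-⊤ ; finZ = finite-⊤ ; pat = λ () ; state = λ _ → initial L FL b
      ; query = λ _ → ε , f-L (initial L FL b)
      ; found = λ Col cover → let (c , p) = cover tt in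
          inj₂ (tt , c ∷ⱽ []ⱽ , (λ { zero zero _ → refl }) , p , λ { zero m → p }) }
    -- Every lengthening multiplies once more from the right and uses up one `∂`.
    chains finI (suc n) L FL b = Lengthen.lengthen finI (chains finI n (∂ L) (idem L FL) b)

    module Conclude {I : Set} (finI : Finite I) {L : Subset} {T : 𝓕ℕ → Set} (evT : Ev T)
      (ch : Chains (length (proj₁ finI)) L (proj₁ evT) I) where

      private module C = Chains ch

      𝓕-all : 𝓕 (λ g → (∀ z → L (proj₁ (C.query z) ∙ g)) × (∀ y a → L ((fn S a (pos (C.pat y)) ∙ pt (C.pat y)) ∙ g)))
      𝓕-all = inter (𝓕-∀ C.finZ (λ z → proj₂ (C.query z))) (𝓕-∀ C.finY (λ y → 𝓕-∀ (finA S) (in-L (C.pat y))))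

      -- A last translation `g` uses up the remaining `∂`; a distinct chain would have more colours
      -- than exist.
      unavoidable : Unavoidable S I L T
      unavoidable with inhabited _ 𝓕-all
      ... | g , qs , ps = record
        { finY = C.finY ; finZ = C.finZ
        ; pat = λ y → pattern-at (pos (C.pat y)) (pt (C.pat y) ∙ g) (proj₂ evT _ (far (C.pat y))) (λ a → subst L (assoc _ _ _) (ps y a))
        ; query = λ z → proj₁ (C.query z) ∙ g , qs z
        ; mono = mono }
        where
        mono : ∀ (Col : I → G → Set) → (∀ z → ∃[ c ] Col c (proj₁ (C.query z) ∙ g)) → _
        mono Col cover with C.found (λ c y → Col c (y ∙ g)) cover
        ... | inj₁ (y , c , p , qs) = y , c , subst (Col c) (assoc _ _ _) p , λ m → subst (Col c) (assoc _ _ _) (qs m)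
        ... | inj₂ (_ , κ , inj , _) = ⊥-elim (vec-repeats finI κ inj)

    recurrent : Recurrent S
    recurrent finI L FL T evT = Conclude.unavoidable finI evT (chains finI (length (proj₁ finI)) L FL (proj₁ evT))

  -- Empty and trivial classes.

  -- Nothing fits an empty list, so only the base needs a colour. By measurability all values at a
  -- late `α` lie in `∂ L`; the value `ε` does because `L` is in `𝓕`.
  recurrent-[] : ∀ S → Fitted [] S → Recurrent S
  recurrent-[] S fit {I} finI L FL T evT = record
    { finY = finite-⊤ ; finZ = finite-⊤
    ; pat = λ _ → pattern-at α (proj₁ chosen) (proj₁ good-α) (proj₂ (proj₂ chosen))
    ; query = λ _ → base S α ∙ proj₁ chosen , proj₁ (proj₂ chosen)
    ; mono = λ Col cover → tt , proj₁ (cover tt) , proj₂ (cover tt) , λ m → ⊥-elim (Any.¬Any[] (fit m)) }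
    where
    measured : ∀ R → 𝒫 R → Ev (λ α → ∂ L (R α))
    measured R p = Ev-map
      (λ { α (inj₁ q) → q ; α (inj₂ eq) → upward FL (λ x l → subst L (trans (sym (identityˡ x)) (cong (_∙ x) (sym eq))) l) })
      (InE⇒Ev (meas R p (∂ L) (idem L FL)))
    ev : Ev (λ α → T α × ∂ L (base S α) × (∀ a → ∂ L (fn S a α)))
    ev = Ev-× evT (Ev-× (measured (base S) (𝒫-base S)) (Ev-∀ (finA S) (λ a → measured (fn S a) (𝒫-fn S a))))
    α : 𝓕ℕ
    α = suc (proj₁ ev) , []
    good-α : T α × ∂ L (base S α) × (∀ a → ∂ L (fn S a α))
    good-α = proj₂ ev α ≤-refl
    chosen : ∃[ x ] (L (base S α ∙ x) × (∀ a → L (fn S a α ∙ x)))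
    chosen = inhabited _ (inter (proj₁ (proj₂ good-α)) (𝓕-∀ (finA S) (proj₂ (proj₂ good-α))))

  module Trivial {l : ℕ} {q : Fun} {cs : List Class} (le : d * nilClass ≤ l) (vq : V l q) (S : System) (fit : Fitted ((l , q) ∷ cs) S) where

    part : ∀ m → V (suc l) (λ α → diff S m α ∙ q α ⁻¹) ⊎ Fits cs (diff S m)
    part m = split (fit m)

    remaining : System
    remaining = record
      { base = base S ; 𝒫-base = 𝒫-base S ; finA = finA S ; fn = fn S ; 𝒫-fn = 𝒫-fn S
      ; M = Σ (M S) λ m → True (isRight (part m))
      ; finM = finite-Σ (finM S) (λ m → finite-T (isRight (part m)))
      ; mem = λ (m , _) → mem S m }

    remaining-fit : Fitted cs remaining
    remaining-fit (m , t) = fromRight (part m) t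

    Agrees : M S → 𝓕ℕ → Set
    Agrees m α = (base S α ≡ fn S (mem S m) α) ⊎ True (isRight (part m))

    Ev-agrees : ∀ m → Ev (Agrees m)
    Ev-agrees m with part m
    ... | inj₂ _ = 0 , λ _ _ → inj₂ tt
    ... | inj₁ v = Ev-map
      (λ α eq → inj₁ (trans (sym (identityˡ _)) (trans (cong (_∙ base S α) (sym eq))
        (solve 2 (λ r n → r :∙ n :⁻¹ :∙ n ⊜ r) refl (fn S (mem S m) α) (base S α)))))
      (V-trivial nilClass nilpotent le (V-absorb (weak (n≤1+n l) v) vq))

    -- Members of a class of so high a level coincide eventually with the base, so a late pattern
    -- for the remaining members serves all of them.
    recurrent : Recurrent remaining → Recurrent S
    recurrent rec {I} finI L FL T evT = record
      { finY = U.finY ; finZ = U.finZ ; query = U.query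
      ; pat = λ y → pattern-at (pos (U.pat y)) (pt (U.pat y)) (proj₁ (far (U.pat y))) (in-L (U.pat y))
      ; mono = λ Col cover → let (y , c , p , ps) = U.mono Col cover in
          y , c , p , λ m → all Col y c p ps m (proj₂ (far (U.pat y)) m) }
      where
      module U = Unavoidable (rec finI L FL (λ α → T α × (∀ m → Agrees m α)) (Ev-× evT (Ev-∀ (finM S) Ev-agrees)))
      all : ∀ (Col : I → G → Set) y c → Col c (base S (pos (U.pat y)) ∙ pt (U.pat y)) →
        (∀ m → Col c (fn S (mem S (proj₁ m)) (pos (U.pat y)) ∙ pt (U.pat y))) →
        ∀ m → Agrees m (pos (U.pat y)) → Col c (fn S (mem S m) (pos (U.pat y)) ∙ pt (U.pat y))
      all Col y c p ps m (inj₁ eq) = subst (λ u → Col c (u ∙ pt (U.pat y))) eq p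
      all Col y c p ps m (inj₂ t)  = ps (m , t)

  -- The PET induction and the theorem.

  recurrence : ∀ {ls} → PET ls → ∀ cs → map proj₁ cs ≡ ls → Classes cs → ∀ S → Fitted cs S → Recurrent S
  recurrence done [] refl cls S fit = recurrent-[] S fit
  recurrence (triv le pet) ((l , q) ∷ cs) refl ((vq , _) ∷ cls) S fit =
    Tr.recurrent (recurrence pet cs refl cls Tr.remaining Tr.remaining-fit)
    where module Tr = Trivial le vq S fit
  recurrence (step pets) ((l , q) ∷ cs) refl cls S fit =
    Focus.recurrent S ((l , q) ∷ cs) cls fit
      (λ S′ fit′ → let (N , p , hs , cs′ , cls′ , levels , fit″) = lower cls S′ fit′ in
        N , p , λ fin z → recurrence (pets hs) cs′ levels cls′ (conjugates (withBase S′ N p) fin z)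
                            (conjugates-fitted cls′ (withBase S′ N p) fit″ fin z))

  -- Every member starts with a class of its own, of level zero, represented by its difference.
  recurrent-all : ∀ S → (∀ m → V 0 (diff S m)) → Recurrent S
  recurrent-all S v = recurrence (PET-all (map proj₁ cs)) cs refl (classes (proj₁ (finM S))) S
      (λ m → Any.map⁺ (lose (proj₂ (finM S) m) (V-≗ (λ α → sym (inverseʳ (diff S m α))) V-ε)))
    where
    cs : List Class
    cs = map (λ m → 0 , diff S m) (proj₁ (finM S))
    classes : ∀ ms → Classes (map (λ m → 0 , diff S m) ms)
    classes []       = []
    classes (m ∷ ms) = (v m , All.map⁺ (All.universal (λ _ → ≤-refl) ms)) ∷ classes ms

  -- An element of K⁻¹A is coloured by some k with k g ∈ A; the twists by the k's turn a
  -- monochromatic pattern of colour k into a pattern in A.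
  syndetic-recurrence : ∀ S → (∀ m → V 0 (diff S m)) → ∀ A → Syndetic 𝓕 A →
    ∃[ α ] ∃[ x ] (∀ m → A (fn S (mem S m) α ∙ x))
  syndetic-recurrence S v A synd with synd (Conjugable S) (𝓕-conjugable S)
  ... | K , allK , 𝓕K = pos p , base S (pos p) ⁻¹ ∙ (z j ∙ (base S (pos p) ∙ pt p)) ,
      λ m → subst A (untwist (base S) (fn S (mem S m)) (z j) (pos p) (pt p)) (proj₂ (proj₂ (proj₂ hit)) (m , j))
    where
    z : Fin (length (toList K)) → G
    z = lookupᴸ (toList K)
    zs : Fin (length (toList K)) → Σ G (Conjugable S)
    zs j = z j , All.lookup allK (∈-lookup j)
    S′ : System
    S′ = conjugates S (finite-Fin _) zs
    v′ : ∀ m → V 0 (diff S′ m)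
    v′ (m , j) = V-≗
      (λ α → solve 3 (λ r n z → (r :∙ n :⁻¹) :^ z ⊜ (r :^ z) :∙ :[ z , n ] :∙ n :⁻¹) refl (fn S (mem S m) α) (base S α) (z j))
      (V-absorb (weak z≤n (V-conj (z j) (v m))) (v m))
    una : Unavoidable S′ (Fin (length (toList K))) (invMul K A) (λ _ → ⊤)
    una = recurrent-all S′ v′ (finite-Fin _) (invMul K A) 𝓕K (λ _ → ⊤) (0 , λ _ _ → tt)
    colour : ∀ {g} → invMul K A g → ∃[ j ] A (z j ∙ g)
    colour w with Any.lookup-index w
    ... | a , Aa , eq = Any.index w ,
      subst A (trans (solve 2 (λ a z → a ⊜ z :∙ (z :⁻¹ :∙ a)) refl a (z (Any.index w))) (cong (z (Any.index w) ∙_) (sym eq))) Aa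
    hit : ∃[ y ] Mono S′ (λ j g → A (z j ∙ g)) (Unavoidable.pat una y)
    hit = Unavoidable.mono una (λ j g → A (z j ∙ g)) (λ u → colour (proj₂ (Unavoidable.query una u)))
    p : Pattern S′ (invMul K A) (λ _ → ⊤)
    p = Unavoidable.pat una (proj₁ hit)
    j : Fin (length (toList K))
    j = proj₁ (proj₂ hit)

theoremA : {G : Set} (_∙_ : G → G → G) (ε : G) (_⁻¹ : G → G) →
    IsGroup _≡_ _∙_ ε _⁻¹ →
    GroupNotions.Nilpotent _∙_ ε _⁻¹ →
    (𝓕 : (G → Set) → Set) →
    GroupNotions.IsFilter _∙_ ε _⁻¹ 𝓕 →
    GroupNotions.Idempotent _∙_ ε _⁻¹ 𝓕 →
    (𝒫 : (𝓕ℕ → G) → Set) →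
    GroupNotions.GoodCollection _∙_ ε _⁻¹ 𝓕 𝒫 →
    (k : ℕ) (P : Fin k → 𝓕ℕ → G) → (∀ i → 𝒫 (P i)) →
    (A : G → Set) → GroupNotions.Syndetic _∙_ ε _⁻¹ 𝓕 A →
    ∃[ α ] ∃[ a ] (∀ i → A (P i α ∙ a))
theoremA _∙_ ε _⁻¹ isGroup nil 𝓕 isFilter idem 𝒫 good zero P 𝒫P A synd = (0 , []) , ε , λ ()
theoremA _∙_ ε _⁻¹ isGroup (nilClass , nilpotent) 𝓕 isFilter idem 𝒫 good k@(suc _) P 𝒫P A synd =
  syndetic-recurrence S (λ i → V-∙ (V-P i) (V-⁻¹ (V-P zero))) A synd
  where
  -- Syndeticity produces an actual element, where `no-∅` yields only a double negation.
  inhabited : ∀ L → 𝓕 L → ∃[ g ] L g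
  inhabited L FL with synd L FL
  ... | K , all , _ = head K , All.head all

  open GroupNotions.GoodCollection good using (poly)

  degree : Fin k → ℕ
  degree i = proj₁ (poly (P i) (𝒫P i))

  -- `Ev` serves as a maximum here: with `d` one more than the bound, `degree i + 1 ≤ d`, as an atom
  -- of weight zero requires.
  bound : Ev (λ α → ∀ i → degree i < minF α)
  bound = Ev-∀ (finite-Fin k) (λ i → Ev-above (degree i))

  open Recurrence _∙_ ε _⁻¹ isGroup 𝓕 isFilter idem 𝒫 good inhabited (proj₁ bound) nilClass nilpotent
    using (System; V; atom; V-∙; V-⁻¹; syndetic-recurrence)

  S : System
  S = record { base = P zero ; 𝒫-base = 𝒫P zero ; finA = finite-Fin k ; finM = finite-Fin k ; fn = P ; 𝒫-fn = 𝒫P ; mem = λ i → i }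

  V-P : ∀ i → V 0 (P i)
  V-P i = atom (proj₂ (poly (P i) (𝒫P i)))
    (subst (_≤ suc (proj₁ bound)) (+-comm 1 (degree i)) (proj₂ bound (suc (proj₁ bound) , []) ≤-refl i))
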